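{- Let $G$ be a multigraph, and let $F$ be a field of characteristic $0$ or $F=\mathbb{Z}_p$ with $p$ prime. Let $(L,C)$ be an $F$-correspondence assignment on $G$ that is $Z$-signable with respect to some orientation $D$ of $G$, with generalized sign function $\varphi_C:E(G)\to\langle 1\rangle\setminus\{0\}$ written as $\varphi_C=\sigma_C\varphi_C^+$, and let $D_{\sigma,\varphi}$ be the associated auxiliary digraph. Suppose that $EE(D_{\sigma,\varphi})-EO(D_{\sigma,\varphi})\not\equiv 0_F$ and that $|L(v)|\ge d^+_D(v)+1$ for each $v\in V(G)$. Then $G$ is $(L,C)$-colorable.
   Context: Graphs. Multigraphs and digraphs are finite and loopless; parallel edges are allowed and are regarded as distinct. Write $e=\{v,w\}$ if $v,w$ are the endpoints of the edge $e$, and $\vec e=(v,w)$ if $\vec e$ is a directed edge from $v$ to $w$. An orientation $D$ of a multigraph $G$ is a digraph on vertex set $V(G)$ obtained by choosing one direction for each edge; $\vec e$ is the directed edge of $D$ corresponding to $e\in E(G)$. $d^+_D(v)$ and $d^-_D(v)$ are the out-degree and in-degree of $v$ in $D$. Eulerian subdigraphs. A digraph $H$ is Eulerian if $d^+_H(v)=d^-_H(v)$ for every vertex $v$ (connectedness is not required). A digraph is even (odd) if it has an even (odd) number of edges. $EE(H)$ and $EO(H)$ denote the numbers of even, respectively odd, spanning Eulerian subdigraphs of $H$ (spanning means having vertex set $V(H)$; the subdigraph with no edges counts). Correspondence assignments. A correspondence assignment $(L,C)$ for $G$ consists of lists $L=\{L(v)\}_{v\in V(G)}$ and a function $C$ assigning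 to every edge $e=\{u,v\}$ a partial matching $C_e$ between $\{u\}\times L(u)$ and $\{v\}\times L(v)$. An $(L,C)$-coloring is a function $f$ with $f(v)\in L(v)$ for all $v\in V(G)$ such that for every edge $e=\{u,v\}$ the pair $\{(u,f(u)),(v,f(v))\}$ is not in $C_e$; $G$ is $(L,C)$-colorable if one exists. For a field $F$, $(L,C)$ is an $F$-correspondence assignment if $L(v)\subseteq F$ for all $v$. $Z$-signable. Let $\langle 1\rangle$ be the additive subgroup of $F$ generated by $1$ (identified with $\mathbb{Z}$ when $F$ has characteristic $0$; equal to $\mathbb{Z}_p$ when $F=\mathbb{Z}_p$). $(L,C)$ is $Z$-signable with respect to an orientation $D$ of $G$ if there is a function $\varphi_C:E(G)\to\langle 1\rangle\setminus\{0\}$ (the generalized sign function of $(L,C)$ with respect to $D$) such that for each $\vec e=(v,w)\in\vec E(D)$ there is $a_{\vec e}\in F$ with $c_1-\varphi_C(e)c_2=a_{\vec e}$ whenever $\{(v,c_1),(w,c_2)\}\in C_e$. One writes $\varphi_C(e)=\sigma_C(e)\varphi_C^+(e)$ with $\sigma_C(e)\in\{1,-1\}$ and $\varphi_C^+(e)$ a positive integer, as follows. If $F$ has characteristic $0$, $\sigma_C(e)$ is the sign of the integer $\varphi_C(e)$ and $\varphi_C^+(e)=|\varphi_C(e)|$. If $F=\mathbb{Z}_p$, $\sigma_C:E(G)\to\{1,-1\}$ may be any function and $\varphi_C^+(e)\in\{1,\dots,p-1\}$ is the integer for which $\varphi_C(e)=\sigma_C(e)\varphi_C^+(e)$ in $\mathbb{Z}_p$.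 Auxiliary digraph. $D_{\sigma,\varphi}$ is obtained from $D$ by replacing each $\vec e=(v,w)\in\vec E(D)$ as follows: delete $\vec e$, add two new vertices $v_{\vec e},w_{\vec e}$ and the edges $(v,v_{\vec e})$, $(w_{\vec e},w)$; if $\sigma_C(e)=1$, add $\varphi_C^+(e)$ parallel edges $\vec e_1,\dots,\vec e_{\varphi_C^+(e)}$ from $v_{\vec e}$ to $w_{\vec e}$; if $\sigma_C(e)=-1$, add new vertices $x^1_{\vec e},\dots,x^{\varphi_C^+(e)}_{\vec e}$ and the edges $(v_{\vec e},x^i_{\vec e})$, $(x^i_{\vec e},w_{\vec e})$ for $1\le i\le\varphi_C^+(e)$. (New vertices for different edges of $D$ are distinct.) For $n\in\mathbb{Z}$, $n\equiv 0_F$ means $n=0$ if $F$ has characteristic $0$, and $n\equiv 0\pmod p$ if $F=\mathbb{Z}_p$. -}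

module Defs where

open import Algebra.Apartness.Bundles using (HeytingField; HeytingCommutativeRing)
open import Algebra.Bundles using (CommutativeRing; RawRing)
import Algebra.Definitions.RawMonoid as RawMonoidDefs
open import Algebra.Morphism.Structures using (IsRingIsomorphism)
open import Axiom.UniquenessOfIdentityProofs using (module Decidable⇒UIP)
open import Data.Fin.Base using (Fin)
import Data.Fin.Properties as Fin
open import Data.Integer.Base as ℤ using (ℤ; 0ℤ; 1ℤ; -[1+_]; _◃_) renaming (+_ to pos)
open import Data.Integer.Divisibility.Signed using (_∣_)
open import Data.List.Base
  using (List; []; _∷_; _++_; map; concatMap; replicate; length; filter; allFin)
open import Data.List.Membership.Propositional using () renaming (_∈_ to _∈ₗ_)
open import Data.List.Membership.Propositional.Properties
  using (∈-allFin; ∈-map⁺; ∈-++⁺ˡ; ∈-++⁺ʳ; ∈-concatMap⁺)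
open import Data.List.Relation.Unary.All as All using (All; []; _∷_)
open import Data.List.Relation.Unary.All.Properties using (concat⁺; map⁺; replicate⁺)
open import Data.List.Relation.Unary.Any as Any using (here; there)
open import Data.Nat.Base as ℕ using (ℕ; suc; parity)
import Data.Nat.Properties as ℕ
open import Data.Nat.Primality using (Prime)
open import Data.Parity.Base using (Parity; 0ℙ; 1ℙ)
import Data.Parity.Properties as Parity
open import Data.Product.Base using (Σ; ∃; _×_; _,_; proj₁; proj₂)
import Data.Product.Properties as Product
open import Data.Sign.Base as Sign using (Sign)
open import Data.Sum.Base using (_⊎_; inj₁; inj₂)
open import Data.Unit.Base using (⊤)
open import Level using (Level; _⊔_; 0ℓ) renaming (suc to lsuc)
open import Relation.Binary.Core using (Rel)
open import Relation.Binary.Definitions using (DecidableEquality; Symmetric; _Respects_)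
open import Relation.Binary.PropositionalEquality
  using (_≡_; _≢_; refl; sym; cong; subst)
open import Relation.Nullary.Decidable using (Dec; yes; no; map′; _×-dec_)
open import Relation.Nullary.Negation using (¬_)
open import Relation.Unary using (Pred; _∈_)

------------------------------------------------------------------------
-- Digraphs

-- A spanning subdigraph is given by a list of arcs in which parallel arcs
-- are separate entries.
record Digraph : Set₁ where
  field
    Vertex   : Set
    _≟_      : DecidableEquality Vertex
    vertices : List Vertex
    complete : ∀ v → v ∈ₗ vertices
    arcs     : List (Vertex × Vertex)
    loopless : All (λ a → proj₁ a ≢ proj₂ a) arcs

  outdegreeIn indegreeIn : List (Vertex × Vertex) → Vertex → ℕ
  outdegreeIn as v = length (filter (λ a → proj₁ a ≟ v) as)
  indegreeIn  as v = length (filter (λ a → proj₂ a ≟ v) as)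

  outdegree : Vertex → ℕ
  outdegree = outdegreeIn arcs

  Eulerian : List (Vertex × Vertex) → Set
  Eulerian as = ∀ v → outdegreeIn as v ≡ indegreeIn as v

  eulerian? : ∀ as → Dec (Eulerian as)
  eulerian? as =
    map′ (λ eq v → All.lookup eq (complete v)) (λ eq → All.tabulate (λ {v} _ → eq v))
         (All.all? (λ v → outdegreeIn as v ℕ.≟ indegreeIn as v) vertices)

-- Sublists are taken by position, so equal entries are distinguished and
-- a list of length m has 2 ^ m sublists.
sublists : ∀ {a} {A : Set a} → List A → List (List A)
sublists []       = [] ∷ []
sublists (x ∷ xs) = sublists xs ++ map (x ∷_) (sublists xs)

eulerianCount : Parity → Digraph → ℕ
eulerianCount π H =
  length (filter (λ as → eulerian? as ×-dec (parity (length as) Parity.≟ π)) (sublists arcs))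
  where open Digraph H

EE EO : Digraph → ℕ
EE = eulerianCount 0ℙ
EO = eulerianCount 1ℙ

------------------------------------------------------------------------
-- Multigraphs and orientations

-- The order in which `endpoints` lists the two ends of an edge carries no
-- meaning; `Joins` forgets it.
record Multigraph : Set where
  field
    order     : ℕ
    size      : ℕ
    endpoints : Fin size → Fin order × Fin order
    loopless  : ∀ e → proj₁ (endpoints e) ≢ proj₂ (endpoints e)

  Vertex Edge : Set
  Vertex = Fin order
  Edge   = Fin size

  Joins : Edge → Vertex → Vertex → Set
  Joins e v w = endpoints e ≡ (v , w) ⊎ endpoints e ≡ (w , v)

  Joins⇒≢ : ∀ {e v w} → Joins e v w → v ≢ w
  Joins⇒≢ {e} (inj₁ eq) v≡w = loopless e (subst (λ a → proj₁ a ≡ proj₂ a) (sym eq) v≡w)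
  Joins⇒≢ {e} (inj₂ eq) v≡w = loopless e (subst (λ a → proj₁ a ≡ proj₂ a) (sym eq) (sym v≡w))

record Orientation (G : Multigraph) : Set where
  open Multigraph G using (Vertex; Edge; Joins; Joins⇒≢)
  field
    source target : Edge → Vertex
    joins         : ∀ e → Joins e (source e) (target e)

  digraph : Digraph
  digraph = record
    { Vertex   = Vertex
    ; _≟_      = Fin._≟_
    ; vertices = allFin _
    ; complete = ∈-allFin
    ; arcs     = map (λ e → source e , target e) (allFin _)
    ; loopless = map⁺ (All.universal (λ e → Joins⇒≢ (joins e)) (allFin _))
    }

------------------------------------------------------------------------
-- The auxiliary digraph

-- The vertices replacing a directed edge e from v to w: `tail` is v_e,
-- `head` is w_e, and the x^i_e exist only when the sign is negative.
data GadgetVertex : Sign → ℕ → Set where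
  tail head : ∀ {s k} → GadgetVertex s k
  mid       : ∀ {k} → Fin k → GadgetVertex Sign.- k

gadgetArcs : ∀ s k → List (GadgetVertex s k × GadgetVertex s k)
gadgetArcs Sign.+ k = replicate k (tail , head)
gadgetArcs Sign.- k = concatMap (λ i → (tail , mid i) ∷ (mid i , head) ∷ []) (allFin k)

module Gadget where

  _≟_ : ∀ {s k} → DecidableEquality (GadgetVertex s k)
  tail  ≟ tail  = yes refl
  tail  ≟ head  = no λ ()
  tail  ≟ mid _ = no λ ()
  head  ≟ tail  = no λ ()
  head  ≟ head  = yes refl
  head  ≟ mid _ = no λ ()
  mid _ ≟ tail  = no λ ()
  mid _ ≟ head  = no λ ()
  mid i ≟ mid j = map′ (cong mid) (λ where refl → refl) (i Fin.≟ j)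

  vertices : ∀ s k → List (GadgetVertex s k)
  vertices Sign.+ k = tail ∷ head ∷ []
  vertices Sign.- k = tail ∷ head ∷ map mid (allFin k)

  complete : ∀ {s k} (x : GadgetVertex s k) → x ∈ₗ vertices s k
  complete {Sign.+} tail = here refl
  complete {Sign.+} head = there (here refl)
  complete {Sign.-} tail = here refl
  complete {Sign.-} head = there (here refl)
  complete (mid i)       = there (there (∈-map⁺ mid (∈-allFin i)))

  loopless : ∀ s k → All (λ a → proj₁ a ≢ proj₂ a) (gadgetArcs s k)
  loopless Sign.+ k = replicate⁺ k (λ ())
  loopless Sign.- k =
    concat⁺ (map⁺ (All.universal (λ _ → (λ ()) ∷ (λ ()) ∷ []) (allFin k)))

module _ {G : Multigraph} (D : Orientation G) where

  open Multigraph G using (Vertex; Edge)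
  open Orientation D using (source; target)

  data AuxVertex (σ : Edge → Sign) (φ⁺ : Edge → ℕ) : Set where
    old : Vertex → AuxVertex σ φ⁺
    new : (e : Edge) → GadgetVertex (σ e) (φ⁺ e) → AuxVertex σ φ⁺

  module _ (σ : Edge → Sign) (φ⁺ : Edge → ℕ) where

    auxArcs : Edge → List (AuxVertex σ φ⁺ × AuxVertex σ φ⁺)
    auxArcs e =
        (old (source e) , new e tail)
      ∷ (new e head , old (target e))
      ∷ map (λ a → new e (proj₁ a) , new e (proj₂ a)) (gadgetArcs (σ e) (φ⁺ e))

    private
      V : Set
      V = AuxVertex σ φ⁺

      pair : ∀ {e x e′ x′} → _≡_ {A = V} (new e x) (new e′ x′) →
             _≡_ {A = Σ Edge (λ e → GadgetVertex (σ e) (φ⁺ e))} (e , x) (e′ , x′)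
      pair refl = refl

      unpair : ∀ {e x e′ x′} →
               _≡_ {A = Σ Edge (λ e → GadgetVertex (σ e) (φ⁺ e))} (e , x) (e′ , x′) →
               _≡_ {A = V} (new e x) (new e′ x′)
      unpair refl = refl

      _≟_ : DecidableEquality V
      old v   ≟ old w     = map′ (cong old) (λ where refl → refl) (v Fin.≟ w)
      old _   ≟ new _ _   = no λ ()
      new _ _ ≟ old _     = no λ ()
      new e x ≟ new e′ x′ =
        map′ unpair pair (Product.≡-dec Fin._≟_ Gadget._≟_ (e , x) (e′ , x′))

      newVertices : Edge → List V
      newVertices e = map (new e) (Gadget.vertices (σ e) (φ⁺ e))

      vertices : List V
      vertices = map old (allFin _) ++ concatMap newVertices (allFin _)

      complete : ∀ v → v ∈ₗ vertices
      complete (old v)   = ∈-++⁺ˡ (∈-map⁺ old (∈-allFin v))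
      complete (new e x) = ∈-++⁺ʳ (map old (allFin _))
        (∈-concatMap⁺ newVertices
          (Any.map (λ where refl → ∈-map⁺ (new e) (Gadget.complete x)) (∈-allFin e)))

      new-injective : ∀ {e x x′} → _≡_ {A = V} (new e x) (new e x′) → x ≡ x′
      new-injective eq =
        Product.,-injectiveʳ-UIP (Decidable⇒UIP.≡-irrelevant Fin._≟_) (pair eq)

      loopless : ∀ e → All (λ a → proj₁ a ≢ proj₂ a) (auxArcs e)
      loopless e = (λ ()) ∷ (λ ())
        ∷ map⁺ (All.map (λ x≢y eq → x≢y (new-injective eq)) (Gadget.loopless (σ e) (φ⁺ e)))

    auxiliary : Digraph
    auxiliary = record
      { Vertex   = V
      ; _≟_      = _≟_
      ; vertices = vertices
      ; complete = complete
      ; arcs     = concatMap auxArcs (allFin _)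
      ; loopless = concat⁺ (map⁺ (All.universal loopless (allFin _)))
      }

------------------------------------------------------------------------
-- Fields of characteristic 0 and the fields ℤ_p

-- Congruence modulo p on ℤ is the equality of this ring.
ℤ/ : ℕ → RawRing 0ℓ 0ℓ
ℤ/ p = record
  { Carrier = ℤ
  ; _≈_     = λ i j → pos p ∣ i ℤ.- j
  ; _+_     = ℤ._+_
  ; _*_     = ℤ._*_
  ; -_      = ℤ.-_
  ; 0#      = 0ℤ
  ; 1#      = 1ℤ
  }

-- In a Heyting field x # y says that x - y is invertible. Classically # is
-- ≉ and Heyting fields are fields; no decidability is assumed of either.
module _ {c ℓ₁ ℓ₂} (F : HeytingField c ℓ₁ ℓ₂) where

  open HeytingField F hiding (sym; refl)
  open CommutativeRing (HeytingCommutativeRing.commutativeRing heytingCommutativeRing)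
    using (rawRing; +-rawMonoid)
  open RawMonoidDefs +-rawMonoid using () renaming (_×_ to _·_)

  infix 9 _·1
  _·1 : ℤ → Carrier
  pos n    ·1 = n · 1#
  -[1+ n ] ·1 = - (suc n · 1#)

  ⟨1⟩ : Pred Carrier ℓ₁
  ⟨1⟩ x = ∃ λ n → x ≈ n ·1

  CharacteristicZero : Set ℓ₂
  CharacteristicZero = ∀ n → (suc n · 1#) # 0#

  IsℤMod : ℕ → Set (c ⊔ ℓ₁)
  IsℤMod p = ∃ (IsRingIsomorphism (ℤ/ p) rawRing)

  data CharZeroOrℤₚ : Set (c ⊔ ℓ₁ ⊔ ℓ₂) where
    char0 : CharacteristicZero → CharZeroOrℤₚ
    ℤₚ    : ∀ p → Prime p → IsℤMod p → CharZeroOrℤₚ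

  AtLeast : ∀ {a} → ℕ → Pred Carrier a → Set (c ⊔ ℓ₂ ⊔ a)
  AtLeast k S = Σ (Fin k → Carrier) λ x → (∀ i → x i ∈ S) × (∀ {i j} → i ≢ j → x i # x j)

------------------------------------------------------------------------
-- Correspondence assignments

  -- C e (v , c) (w , d) says that the unordered pair {(v , c) , (w , d)}
  -- belongs to the partial matching on the edge e.
  record CorrespondenceAssignment (G : Multigraph) (a b : Level)
         : Set (c ⊔ ℓ₁ ⊔ lsuc (a ⊔ b)) where
    open Multigraph G using (Vertex; Edge; Joins)
    field
      L          : Vertex → Pred Carrier a
      L-resp-≈   : ∀ v → L v Respects _≈_
      C          : Edge → Rel (Vertex × Carrier) b
      C-resp-≈   : ∀ e {v w x x′ y y′} → x ≈ x′ → y ≈ y′ →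
                   C e (v , x) (w , y) → C e (v , x′) (w , y′)
      C-sym      : ∀ e → Symmetric (C e)
      C-between  : ∀ e {v w x y} → C e (v , x) (w , y) → Joins e v w × x ∈ L v × y ∈ L w
      C-matching : ∀ e {v w x y y′} → C e (v , x) (w , y) → C e (v , x) (w , y′) → y ≈ y′

    IsColoring : (Vertex → Carrier) → Set (a ⊔ b)
    IsColoring f = (∀ v → f v ∈ L v)
                 × (∀ e v w → Joins e v w → ¬ C e (v , f v) (w , f w))

    Colorable : Set (c ⊔ a ⊔ b)
    Colorable = ∃ IsColoring

module _ {c ℓ₁ ℓ₂} {F : HeytingField c ℓ₁ ℓ₂} where

  open HeytingField F hiding (sym; refl)

  infix 4 _≡0[_]
  _≡0[_] : ℤ → CharZeroOrℤₚ F → Set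
  n ≡0[ char0 _  ] = n ≡ 0ℤ
  n ≡0[ ℤₚ p _ _ ] = pos p ∣ n

  record IsGeneralizedSign {G : Multigraph} {a b} (A : CorrespondenceAssignment F G a b)
                           (D : Orientation G) (φ : Multigraph.Edge G → Carrier)
         : Set (c ⊔ ℓ₁ ⊔ ℓ₂ ⊔ b) where
    open CorrespondenceAssignment A using (C)
    open Orientation D using (source; target)
    field
      integral : ∀ e → φ e ∈ ⟨1⟩ F
      nonzero  : ∀ e → φ e # 0#
      affine   : ∀ e → ∃ λ a → ∀ {x y} → C e (source e , x) (target e , y) → x - φ e * y ≈ a

  Reduced : CharZeroOrℤₚ F → ℕ → Set
  Reduced (char0 _)  k = ⊤
  Reduced (ℤₚ p _ _) k = k ℕ.< p

  -- In characteristic 0 these conditions determine σ and φ⁺ as the sign and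
  -- the absolute value; in ℤ_p they leave σ arbitrary and determine φ⁺.
  record IsSignDecomposition {E : Set} (K : CharZeroOrℤₚ F) (φ : E → Carrier)
                             (σ : E → Sign) (φ⁺ : E → ℕ) : Set ℓ₁ where
    field
      decomposes : ∀ e → φ e ≈ _·1 F (σ e ◃ φ⁺ e)
      positive   : ∀ e → 0 ℕ.< φ⁺ e
      reduced    : ∀ e → Reduced K (φ⁺ e)

{-# OPTIONS --safe #-}

-- Let a_e be the constant with x - φ(e) y = a_e on C_e. A point f of ∏ L(v) with P(f) ≠ 0,
-- where P = ∏ (x_v - φ(e) x_w - a_e) over the arcs (v , w) of D, is a colouring. The degree of P
-- is at most |E| = ∑ d⁺(v), so the tensor product of the divided differences on d⁺(v) + 1
-- elements of each L(v) sends P to the coefficient of ∏ x_v ^ d⁺(v); being a combination of the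
-- values of P, it is apart from 0 only if one of these values is.
-- Choosing x_w instead of x_v in the factor of an arc contributes -φ(e) and moves one unit of
-- degree from v to w, so that this coefficient is the sum of ∏ (-φ(e)) over the Eulerian
-- subdigraphs of D. In the auxiliary digraph every arc has weight -1. Arcs in series multiply
-- their weights and arcs in parallel add them, so the gadget of e acts as an arc of weight -φ(e),
-- and the sum equals EE - EO.
module Submission where

open import Defs
open import Algebra.Apartness.Bundles using (HeytingField; HeytingCommutativeRing)
import Algebra.Apartness.Properties.HeytingCommutativeRing as HeytingProperties
open import Algebra.Bundles using (CommutativeRing)
open import Algebra.Morphism.Structures using (IsRingIsomorphism)
import Algebra.Properties.CommutativeMonoid.Sum as Sum
import Algebra.Properties.Ring as RingProperties
import Algebra.Properties.Semiring.Mult as Mult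
import Algebra.Solver.Ring as RingSolver
open import Algebra.Solver.Ring.AlmostCommutativeRing
  using (AlmostCommutativeRing; fromCommutativeRing; _-Raw-AlmostCommutative⟶_)
open import Data.Fin.Base using (Fin; zero; suc)
import Data.Fin.Properties as Fin
open import Data.Integer.Base as ℤ
  using (ℤ; 0ℤ; 1ℤ; -[1+_]; _⊖_; _◃_; ∣_∣) renaming (+_ to pos)
open import Data.Integer.Divisibility.Signed using (∣ᵤ⇒∣)
import Data.Integer.Properties as ℤ
open import Data.Integer.Tactic.RingSolver using (solve-∀)
open import Data.List.Base
  using (List; []; _∷_; _++_; map; concatMap; foldr; replicate; length; filter; allFin)
open import Data.List.Fresh as Fresh using (List#; []; cons)
open import Data.List.Fresh.Relation.Unary.All using ([]; _∷_) renaming (All to All#)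
open import Data.List.Membership.Propositional using () renaming (_∈_ to _∈ₗ_)
open import Data.List.Membership.Propositional.Properties using (∈-allFin)
open import Data.List.Properties using (map-++; map-∘; map-replicate; length-map; length-tabulate)
open import Data.List.Relation.Unary.All as All using (All; []; _∷_)
open import Data.List.Relation.Unary.All.Properties using (++⁺; map⁺; map⁻)
open import Data.List.Relation.Unary.AllPairs using ([]; _∷_)
open import Data.List.Relation.Unary.Unique.Propositional using (Unique)
open import Data.List.Relation.Unary.Unique.Propositional.Properties using (allFin⁺)
open import Data.Maybe.Base using (Maybe; just; nothing)
open import Data.Nat.Base as ℕ using (ℕ; zero; suc; pred; parity; z≤n; s≤s)
open import Data.Nat.Coprimality using (Coprime; coprime-Bézout)
import Data.Nat.Divisibility as ℕ
open import Data.Nat.GCD using (module Bézout)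
open import Data.Nat.Primality using (Prime; prime⇒irreducible)
import Data.Nat.Properties as ℕ
open import Data.Parity.Base using (Parity; 0ℙ; 1ℙ)
import Data.Parity.Properties as Parity
open import Data.Product.Base using (∃; _×_; _,_; proj₁; proj₂)
open import Data.Sign.Base as Sign using (Sign)
open import Data.Sum.Base using (_⊎_; inj₁; inj₂)
open import Data.Unit.Polymorphic.Base using (tt)
open import Data.Vec.Functional as Vector using (Vector; updateAt)
open import Data.Vec.Functional.Properties using (map-updateAt; updateAt-minimal; updateAt-updates)
open import Level using (_⊔_)
open import Relation.Binary.Definitions using (DecidableEquality)
open import Relation.Binary.PropositionalEquality as ≡ using (_≡_; _≢_)
import Relation.Binary.Reasoning.Setoid as SetoidReasoning
open import Relation.Nullary.Decidable using (Dec; yes; no; map′; _×-dec_)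
open import Relation.Nullary.Negation using (¬_; contradiction)
open import Relation.Unary using (_∈_)
open Sum ℕ.+-0-commutativeMonoid using (sum; sum-cong-≗)

-- Weighted sums over sets of arcs with prescribed net outflow.

module WeightedCounts where

  open import Data.Integer.Base
    using (ℤ; 0ℤ; 1ℤ; -1ℤ; +_; +[1+_]; -[1+_]; _+_; _-_; _*_; -_; _^_; _◃_)
  open import Relation.Binary.PropositionalEquality
    using (refl; sym; trans; cong; cong₂; subst; module ≡-Reasoning)

  indicator : ∀ {p} {P : Set p} → Dec P → ℤ
  indicator (yes _) = 1ℤ
  indicator (no _)  = 0ℤ

  indicator-cong : ∀ {p q} {P : Set p} {Q : Set q} → (P → Q) → (Q → P) →
                   (P? : Dec P) (Q? : Dec Q) → indicator P? ≡ indicator Q?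
  indicator-cong f g (yes p) (yes q) = refl
  indicator-cong f g (yes p) (no ¬q) = contradiction (f p) ¬q
  indicator-cong f g (no ¬p) (yes q) = contradiction (g q) ¬p
  indicator-cong f g (no ¬p) (no ¬q) = refl

  indicator-yes : ∀ {p} {P : Set p} → P → (P? : Dec P) → indicator P? ≡ 1ℤ
  indicator-yes p (yes _) = refl
  indicator-yes p (no ¬p) = contradiction p ¬p

  indicator-no : ∀ {p} {P : Set p} → ¬ P → (P? : Dec P) → indicator P? ≡ 0ℤ
  indicator-no ¬p (yes p) = contradiction p ¬p
  indicator-no ¬p (no _)  = refl

  WeightedArc : Set → Set
  WeightedArc V = ℤ × V × V

  module Circulations {V : Set} (_≟_ : DecidableEquality V)
                      (vertices : List V) (complete : ∀ v → v ∈ₗ vertices) where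

    δ : V → V → ℤ
    δ u v = indicator (u ≟ v)

    -- The function `b` accumulates the net outflow of the arcs kept so far; the inductions over
    -- lists of arcs need its initial value to be arbitrary.
    infixl 6 _⊕_
    _⊕_ : (V → ℤ) → V × V → V → ℤ
    (b ⊕ (s , t)) v = b v + δ s v - δ t v

    balanced? : (b : V → ℤ) → Dec (∀ v → b v ≡ 0ℤ)
    balanced? b = map′ (λ eq v → All.lookup eq (complete v)) (λ eq → All.tabulate (λ {v} _ → eq v))
                       (All.all? (λ v → b v ℤ.≟ 0ℤ) vertices)

    -- The sum, over the sublists of ms whose net outflow is - b, of the products of their weights.
    circ : List (WeightedArc V) → (V → ℤ) → ℤ
    circ []             b = indicator (balanced? b)
    circ ((w , a) ∷ ms) b = circ ms b + w * circ ms (b ⊕ a)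

    circ-cong : ∀ ms {b b′} → (∀ v → b v ≡ b′ v) → circ ms b ≡ circ ms b′
    circ-cong [] eq = indicator-cong (λ z v → trans (sym (eq v)) (z v)) (λ z v → trans (eq v) (z v)) _ _
    circ-cong ((w , s , t) ∷ ms) eq =
      cong₂ (λ i j → i + w * j) (circ-cong ms eq)
        (circ-cong ms (λ v → cong (λ z → z + δ s v - δ t v) (eq v)))

    Avoids : V → WeightedArc V → Set
    Avoids x (_ , s , t) = s ≢ x × t ≢ x

    ⊕-avoids : ∀ b {x s t} → s ≢ x → t ≢ x → (b ⊕ (s , t)) x ≡ b x
    ⊕-avoids b {x} {s} {t} s≢x t≢x
      rewrite indicator-no s≢x (s ≟ x) | indicator-no t≢x (t ≟ x) = rearrange (b x)
      where
      rearrange : ∀ i → i + 0ℤ - 0ℤ ≡ i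
      rearrange = solve-∀

    ⊕-source : ∀ b {s t} → t ≢ s → (b ⊕ (s , t)) s ≡ b s + 1ℤ
    ⊕-source b {s} {t} t≢s
      rewrite indicator-yes refl (s ≟ s) | indicator-no t≢s (t ≟ s) = ℤ.+-identityʳ _

    ⊕-target : ∀ b {s t} → s ≢ t → (b ⊕ (s , t)) t ≡ b t - 1ℤ
    ⊕-target b {s} {t} s≢t
      rewrite indicator-yes refl (t ≟ t) | indicator-no s≢t (s ≟ t) = cong (_- 1ℤ) (ℤ.+-identityʳ (b t))

    ⊕-path : ∀ b s x t v → (b ⊕ (s , x) ⊕ (x , t)) v ≡ (b ⊕ (s , t)) v
    ⊕-path b s x t v = rearrange (b v) (δ s v) (δ x v) (δ t v)
      where
      rearrange : ∀ i j k l → i + j - k + k - l ≡ i + j - l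
      rearrange = solve-∀

    -- No choice among `ms` changes the imbalance at `x`, so it is still nonzero when the final
    -- indicator is reached.
    circ-avoids : ∀ {x ms b} → All (Avoids x) ms → b x ≢ 0ℤ → circ ms b ≡ 0ℤ
    circ-avoids {x} {b = b} [] bx≢0 = indicator-no (λ z → bx≢0 (z x)) (balanced? b)
    circ-avoids {b = b} (_∷_ {x = w , _} (s≢x , t≢x) avoids) bx≢0 =
      trans (cong₂ (λ i j → i + w * j) (circ-avoids avoids bx≢0)
              (circ-avoids avoids (λ eq → bx≢0 (trans (sym (⊕-avoids b s≢x t≢x)) eq))))
            (trans (ℤ.+-identityˡ (w * 0ℤ)) (ℤ.*-zeroʳ w))

    -- Keeping exactly one of the two arcs leaves an imbalance of 1 or -1 at `x` that no arc of `ms`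
    -- can repair. Keeping neither or both corresponds to dropping or keeping the single arc.
    circ-series : ∀ {s x t u w ms b} → s ≢ x → t ≢ x → All (Avoids x) ms → b x ≡ 0ℤ →
                  circ ((u , s , x) ∷ (w , x , t) ∷ ms) b ≡ circ ((u * w , s , t) ∷ ms) b
    circ-series {s} {x} {t} {u} {w} {ms} {b} s≢x t≢x avoids bx≡0 = begin
      circ ms b + w * circ ms (b ⊕ (x , t)) +
        u * (circ ms (b ⊕ (s , x)) + w * circ ms (b ⊕ (s , x) ⊕ (x , t)))
        ≡⟨ cong₂ (λ i j → circ ms b + w * i + u * j)
             (circ-avoids avoids (λ eq → contradiction (trans (sym second) eq) λ ()))
             (cong₂ (λ i j → i + w * j)
               (circ-avoids avoids (λ eq → contradiction (trans (sym first) eq) λ ()))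
               (circ-cong ms (⊕-path b s x t))) ⟩
      circ ms b + w * 0ℤ + u * (0ℤ + w * circ ms (b ⊕ (s , t)))
        ≡⟨ rearrange (circ ms b) u w (circ ms (b ⊕ (s , t))) ⟩
      circ ms b + u * w * circ ms (b ⊕ (s , t)) ∎
      where
      open ≡-Reasoning
      first : (b ⊕ (s , x)) x ≡ -1ℤ
      first = trans (⊕-target b s≢x) (cong (_- 1ℤ) bx≡0)
      second : (b ⊕ (x , t)) x ≡ 1ℤ
      second = trans (⊕-source b t≢x) (cong (_+ 1ℤ) bx≡0)
      rearrange : ∀ i u w j → i + w * 0ℤ + u * (0ℤ + w * j) ≡ i + u * w * j
      rearrange = solve-∀

    module _ {s t : V} (t≢s : t ≢ s) (u : ℤ) {ms : List (WeightedArc V)} (avoids : All (Avoids s) ms) where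

      private
        parallel : ℕ → List (WeightedArc V)
        parallel k = replicate k (u , s , t) ++ ms

      -- Every copy kept raises the imbalance at `s` by one and `ms` never changes it, so exactly
      -- `- b s` copies must be kept. The values treated here and below are the positive ones, 0 and
      -- -1.
      circ-parallel-positive : ∀ k {b n} → b s ≡ +[1+ n ] → circ (parallel k) b ≡ 0ℤ
      circ-parallel-positive zero    bs = circ-avoids avoids (λ eq → contradiction (trans (sym bs) eq) λ ())
      circ-parallel-positive (suc k) {b} bs =
        trans (cong₂ (λ i j → i + u * j) (circ-parallel-positive k bs)
                (circ-parallel-positive k (trans (⊕-source b t≢s) (cong (_+ 1ℤ) bs))))
              (trans (ℤ.+-identityˡ (u * 0ℤ)) (ℤ.*-zeroʳ u))

      circ-parallel-zero : ∀ k {b} → b s ≡ 0ℤ → circ (parallel k) b ≡ circ ms b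
      circ-parallel-zero zero    bs = refl
      circ-parallel-zero (suc k) {b} bs =
        trans (cong₂ (λ i j → i + u * j) (circ-parallel-zero k bs)
                (circ-parallel-positive k (trans (⊕-source b t≢s) (cong (_+ 1ℤ) bs))))
              (trans (cong (λ i → circ ms b + i) (ℤ.*-zeroʳ u)) (ℤ.+-identityʳ (circ ms b)))

      -- Exactly one copy is kept, which gives `k` equal terms: either the first copy cancels the
      -- deficit and the others are dropped, or the choice falls on a later one.
      circ-parallel-negative : ∀ k {b} → b s ≡ -1ℤ →
                               circ (parallel k) b ≡ + k * u * circ ms (b ⊕ (s , t))
      circ-parallel-negative zero    bs = circ-avoids avoids (λ eq → contradiction (trans (sym bs) eq) λ ())
      circ-parallel-negative (suc k) {b} bs =
        trans (cong₂ (λ i j → i + u * j) (circ-parallel-negative k bs)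
                (circ-parallel-zero k (trans (⊕-source b t≢s) (cong (_+ 1ℤ) bs))))
              (rearrange (+ k) u (circ ms (b ⊕ (s , t))))
        where
        rearrange : ∀ i u j → i * u * j + u * j ≡ (1ℤ + i) * u * j
        rearrange = solve-∀

    -- The gadget acts as one arc from v to w: b x = 0 forces (v , x) to be followed by exactly one of
    -- the parallel arcs, and b y = 0 then forces (y , w).
    circ-gadget : ∀ {v w x y ms b} k u → x ≢ y → v ≢ x → w ≢ x → v ≢ y → w ≢ y →
                  All (Avoids x) ms → All (Avoids y) ms → b x ≡ 0ℤ → b y ≡ 0ℤ →
                  circ ((-1ℤ , v , x) ∷ (-1ℤ , y , w) ∷ replicate k (u , x , y) ++ ms) b ≡
                  circ ((+ k * u , v , w) ∷ ms) b
    circ-gadget {v} {w} {x} {y} {ms} {b} k u x≢y v≢x w≢x v≢y w≢y avoidsˣ avoidsʸ bx by = begin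
      circ ks b + -1ℤ * circ ks (b ⊕ (y , w)) +
        -1ℤ * (circ ks (b ⊕ (v , x)) + -1ℤ * circ ks (b ⊕ (v , x) ⊕ (y , w)))
        ≡⟨ cong₂ (λ i j → i + -1ℤ * j)
             (cong₂ (λ i j → i + -1ℤ * j) (circ-parallel-zero y≢x u avoidsˣ k bx) head-only)
             (cong₂ (λ i j → i + -1ℤ * j) tail-only both) ⟩
      circ ms b + -1ℤ * 0ℤ + -1ℤ * (+ k * u * 0ℤ + -1ℤ * (+ k * u * circ ms (b ⊕ (v , w))))
        ≡⟨ rearrange (circ ms b) (+ k * u) (circ ms (b ⊕ (v , w))) ⟩
      circ ms b + + k * u * circ ms (b ⊕ (v , w)) ∎
      where
      open ≡-Reasoning
      ks = replicate k (u , x , y) ++ ms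
      y≢x = λ eq → x≢y (sym eq)
      head-only : circ ks (b ⊕ (y , w)) ≡ 0ℤ
      head-only = trans
        (circ-parallel-zero y≢x u avoidsˣ k (trans (⊕-avoids b y≢x w≢x) bx))
        (circ-avoids avoidsʸ (λ eq → contradiction
          (trans (sym (trans (⊕-source b w≢y) (cong (_+ 1ℤ) by))) eq) λ ()))
      bvx : (b ⊕ (v , x)) x ≡ -1ℤ
      bvx = trans (⊕-target b v≢x) (cong (_- 1ℤ) bx)
      tail-only : circ ks (b ⊕ (v , x)) ≡ + k * u * 0ℤ
      tail-only = trans (circ-parallel-negative y≢x u avoidsˣ k bvx)
        (cong (λ i → + k * u * i) (trans (circ-cong ms (⊕-path b v x y))
          (circ-avoids avoidsʸ (λ eq → contradiction
            (trans (sym (trans (⊕-target b v≢y) (cong (_- 1ℤ) by))) eq) λ ()))))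
      both : circ ks (b ⊕ (v , x) ⊕ (y , w)) ≡ + k * u * circ ms (b ⊕ (v , w))
      both = trans
        (circ-parallel-negative y≢x u avoidsˣ k (trans (⊕-avoids (b ⊕ (v , x)) y≢x w≢x) bvx))
        (cong (λ i → + k * u * i) (circ-cong ms λ z →
          cancel (b z) (δ v z) (δ x z) (δ y z) (δ w z)))
        where
        cancel : ∀ i v x y w → i + v - x + y - w + x - y ≡ i + v - w
        cancel = solve-∀
      rearrange : ∀ i c j → i + -1ℤ * 0ℤ + -1ℤ * (c * 0ℤ + -1ℤ * (c * j)) ≡ i + c * j
      rearrange = solve-∀

  -- Signed counts over sublists, and EE - EO as a weighted sum.

  total : ∀ {a} {A : Set a} → (A → ℤ) → List A → ℤ
  total f = foldr (λ x i → f x + i) 0ℤ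

  module _ {a} {A : Set a} where

    total-cong : ∀ {f g : A → ℤ} → (∀ x → f x ≡ g x) → ∀ xs → total f xs ≡ total g xs
    total-cong eq []       = refl
    total-cong eq (x ∷ xs) = cong₂ _+_ (eq x) (total-cong eq xs)

    total-++ : ∀ (f : A → ℤ) xs ys → total f (xs ++ ys) ≡ total f xs + total f ys
    total-++ f []       ys = sym (ℤ.+-identityˡ _)
    total-++ f (x ∷ xs) ys = trans (cong (λ i → f x + i) (total-++ f xs ys)) (sym (ℤ.+-assoc (f x) _ _))

    total-map : ∀ {b} {B : Set b} (f : A → ℤ) (g : B → A) xs → total f (map g xs) ≡ total (λ x → f (g x)) xs
    total-map f g []       = refl
    total-map f g (x ∷ xs) = cong (λ i → f (g x) + i) (total-map f g xs)

    total-*ˡ : ∀ c (f : A → ℤ) xs → total (λ x → c * f x) xs ≡ c * total f xs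
    total-*ˡ c f []       = sym (ℤ.*-zeroʳ c)
    total-*ˡ c f (x ∷ xs) = trans (cong (λ i → c * f x + i) (total-*ˡ c f xs)) (sym (ℤ.*-distribˡ-+ c _ _))

  sgn : ℕ → ℤ
  sgn n = -1ℤ ^ n

  sgn-2+ : ∀ n → sgn (suc (suc n)) ≡ sgn n
  sgn-2+ n = twice (sgn n)
    where
    twice : ∀ i → -1ℤ * (-1ℤ * i) ≡ i
    twice = solve-∀

  sgn-even : ∀ n → parity n ≡ 0ℙ → sgn n ≡ 1ℤ
  sgn-even zero          _  = refl
  sgn-even (suc (suc n)) eq = trans (sgn-2+ n) (sgn-even n eq)

  sgn-odd : ∀ n → parity n ≡ 1ℙ → sgn n ≡ -1ℤ
  sgn-odd (suc zero)    _  = refl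
  sgn-odd (suc (suc n)) eq = trans (sgn-2+ n) (sgn-odd n eq)

  module _ {a p} {A : Set a} {P : A → Set p} (P? : ∀ x → Dec (P x)) (size : A → ℕ) where

    count : Parity → List A → ℕ
    count π xs = length (filter (λ x → P? x ×-dec (parity (size x) Parity.≟ π)) xs)

    parity-difference : ∀ xs → + count 0ℙ xs - + count 1ℙ xs ≡
      total (λ x → sgn (size x) * indicator (P? x)) xs
    parity-difference [] = refl
    parity-difference (x ∷ xs) with P? x | parity (size x) in eq
    ... | no  _ | _  = trans (parity-difference xs)
      (sym (trans (cong (_+ _) (ℤ.*-zeroʳ (sgn (size x)))) (ℤ.+-identityˡ _)))
    ... | yes _ | 0ℙ = trans (rearrange (+ count 0ℙ xs) (+ count 1ℙ xs))
      (cong₂ _+_ (sym (cong (_* 1ℤ) (sgn-even (size x) eq))) (parity-difference xs))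
      where
      rearrange : ∀ i j → (1ℤ + i) - j ≡ 1ℤ * 1ℤ + (i - j)
      rearrange = solve-∀
    ... | yes _ | 1ℙ = trans (rearrange (+ count 0ℙ xs) (+ count 1ℙ xs))
      (cong₂ _+_ (sym (cong (_* 1ℤ) (sgn-odd (size x) eq))) (parity-difference xs))
      where
      rearrange : ∀ i j → i - (1ℤ + j) ≡ -1ℤ * 1ℤ + (i - j)
      rearrange = solve-∀

  module SignedCount (H : Digraph) where

    open Digraph H
    open Circulations _≟_ vertices complete

    +outdegreeIn-∷ : ∀ s t as v → + outdegreeIn ((s , t) ∷ as) v ≡ δ s v + + outdegreeIn as v
    +outdegreeIn-∷ s t as v with s ≟ v
    ... | yes _ = refl
    ... | no  _ = sym (ℤ.+-identityˡ _)

    +indegreeIn-∷ : ∀ s t as v → + indegreeIn ((s , t) ∷ as) v ≡ δ t v + + indegreeIn as v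
    +indegreeIn-∷ s t as v with t ≟ v
    ... | yes _ = refl
    ... | no  _ = sym (ℤ.+-identityˡ _)

    excess : (Vertex → ℤ) → List (Vertex × Vertex) → Vertex → ℤ
    excess b as v = b v + (+ outdegreeIn as v - + indegreeIn as v)

    -- `circ` branches on the first arc exactly as `sublists` does. The factors -1 of the kept arcs
    -- make up `sgn (length bs)`, and the accumulated imbalance ends as `excess b bs`.
    circ-sublists : ∀ as b → circ (map (-1ℤ ,_) as) b ≡
      total (λ bs → sgn (length bs) * indicator (balanced? (excess b bs))) (sublists as)
    circ-sublists [] b = begin
      indicator (balanced? b)
        ≡⟨ circ-cong [] (λ v → ℤ.+-identityʳ (b v)) ⟨
      indicator (balanced? (excess b []))
        ≡⟨ rearrange (indicator (balanced? (excess b []))) ⟨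
      1ℤ * indicator (balanced? (excess b [])) + 0ℤ ∎
      where
      open ≡-Reasoning
      rearrange : ∀ i → 1ℤ * i + 0ℤ ≡ i
      rearrange = solve-∀
    circ-sublists (a@(s , t) ∷ as) b = begin
      circ (map (-1ℤ ,_) as) b + -1ℤ * circ (map (-1ℤ ,_) as) (b ⊕ a)
        ≡⟨ cong₂ (λ i j → i + -1ℤ * j) (circ-sublists as b) (circ-sublists as (b ⊕ a)) ⟩
      total (term b) (sublists as) + -1ℤ * total (term (b ⊕ a)) (sublists as)
        ≡⟨ cong (λ i → total (term b) (sublists as) + i) (total-*ˡ -1ℤ (term (b ⊕ a)) (sublists as)) ⟨
      total (term b) (sublists as) + total (λ bs → -1ℤ * term (b ⊕ a) bs) (sublists as)
        ≡⟨ cong (λ i → total (term b) (sublists as) + i) (total-cong step (sublists as)) ⟩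
      total (term b) (sublists as) + total (λ bs → term b (a ∷ bs)) (sublists as)
        ≡⟨ cong (λ i → total (term b) (sublists as) + i) (total-map (term b) (a ∷_) (sublists as)) ⟨
      total (term b) (sublists as) + total (term b) (map (a ∷_) (sublists as))
        ≡⟨ total-++ (term b) (sublists as) _ ⟨
      total (term b) (sublists (a ∷ as)) ∎
      where
      open ≡-Reasoning
      term : (Vertex → ℤ) → List (Vertex × Vertex) → ℤ
      term b bs = sgn (length bs) * indicator (balanced? (excess b bs))
      regroup : ∀ i s t o j → i + s - t + (o - j) ≡ i + ((s + o) - (t + j))
      regroup = solve-∀
      step : ∀ bs → -1ℤ * term (b ⊕ a) bs ≡ term b (a ∷ bs)
      step bs = trans (sym (ℤ.*-assoc -1ℤ (sgn (length bs)) _))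
        (cong (sgn (suc (length bs)) *_) (circ-cong [] λ v →
          trans (regroup (b v) (δ s v) (δ t v) (+ outdegreeIn bs v) (+ indegreeIn bs v))
                (cong₂ (λ i j → b v + (i - j)) (sym (+outdegreeIn-∷ s t bs v)) (sym (+indegreeIn-∷ s t bs v)))))

    -- Starting from zero, the excess vanishes at every vertex exactly when the sublist is Eulerian,
    -- and the sign of its length separates the even ones from the odd ones.
    EE-EO : + EE H - + EO H ≡ circ (map (-1ℤ ,_) arcs) (λ _ → 0ℤ)
    EE-EO = trans (parity-difference eulerian? length (sublists arcs))
      (sym (trans (circ-sublists arcs (λ _ → 0ℤ)) (total-cong agree (sublists arcs))))
      where
      agree : ∀ as → sgn (length as) * indicator (balanced? (excess (λ _ → 0ℤ) as)) ≡
                     sgn (length as) * indicator (eulerian? as)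
      agree as = cong (sgn (length as) *_) (indicator-cong
        (λ z v → ℤ.+-injective (ℤ.i-j≡0⇒i≡j _ _ (trans (sym (ℤ.+-identityˡ _)) (z v))))
        (λ z v → trans (ℤ.+-identityˡ _) (ℤ.i≡j⇒i-j≡0 (cong +_ (z v))))
        _ _)

  -- Contraction of the gadgets of the auxiliary digraph.

  module GadgetContraction {V : Set} (_≟_ : DecidableEquality V)
                           (vertices : List V) (complete : ∀ v → v ∈ₗ vertices) where

    open Circulations _≟_ vertices complete

    -- One connection from `tail` to `head` is a single arc of weight -1 for the positive sign, and
    -- two arcs in series, of weight (-1)(-1), for the negative sign.
    pathWeight : Sign → ℤ
    pathWeight Sign.+ = -1ℤ
    pathWeight Sign.- = 1ℤ

    image : ∀ {s k} → (GadgetVertex s k → V) →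
            GadgetVertex s k × GadgetVertex s k → WeightedArc V
    image ι (x , y) = -1ℤ , ι x , ι y

    -- `tail` and `head` are exempt because the arcs attaching the gadget to the graph, and the
    -- connections inside it, change the balance there.
    MidsBalanced : ∀ {s k} → (GadgetVertex s k → V) → (V → ℤ) → Set
    MidsBalanced ι b = ∀ x → x ≢ tail → x ≢ head → b (ι x) ≡ 0ℤ

    module _ {k} {ι : GadgetVertex Sign.- k → V} (injective : ∀ {x y} → ι x ≡ ι y → x ≡ y)
             {ms : List (WeightedArc V)} (avoids : ∀ x → All (Avoids (ι x)) ms) where

      private
        path : Fin k → List (GadgetVertex Sign.- k × GadgetVertex Sign.- k)
        path i = (tail , mid i) ∷ (mid i , head) ∷ []

        mid-injective : ∀ {i j : Fin k} → _≡_ {A = GadgetVertex Sign.- k} (mid i) (mid j) → i ≡ j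
        mid-injective refl = refl

      -- The other paths run through other middle vertices, so `mid i` has only its own two arcs and
      -- `circ-series` applies to it.
      paths-avoid : ∀ {i} is → All (i ≢_) is →
                    All (Avoids (ι (mid i))) (map (image ι) (concatMap path is) ++ ms)
      paths-avoid {i} []       []        = avoids (mid i)
      paths-avoid {i} (j ∷ is) (i≢j ∷ ∉) =
        ((λ eq → contradiction (injective eq) λ ()) , λ eq → i≢j (sym (mid-injective (injective eq)))) ∷
        ((λ eq → i≢j (sym (mid-injective (injective eq)))) , λ eq → contradiction (injective eq) λ ()) ∷
        paths-avoid is ∉

      -- A contracted path joins `tail` to `head`, so keeping it leaves the middle vertices of the
      -- remaining paths balanced, and the paths can be contracted one at a time.
      circ-paths : ∀ is → Unique is → ∀ b → MidsBalanced ι b →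
                   circ (map (image ι) (concatMap path is) ++ ms) b ≡
                   circ (replicate (length is) (1ℤ , ι tail , ι head) ++ ms) b
      circ-paths []       []        b mids = refl
      circ-paths (i ∷ is) (∉ ∷ is!) b mids = trans
        (circ-series {u = -1ℤ} {w = -1ℤ}
          (λ eq → contradiction (injective eq) λ ()) (λ eq → contradiction (injective eq) λ ())
          (paths-avoid is ∉) (mids (mid i) (λ ()) (λ ())))
        (cong₂ (λ i j → i + 1ℤ * j) (circ-paths is is! b mids)
          (circ-paths is is! (b ⊕ (ι tail , ι head)) λ x x≢tail x≢head →
          trans (⊕-avoids b (λ eq → x≢tail (sym (injective eq))) (λ eq → x≢head (sym (injective eq))))
                (mids x x≢tail x≢head)))

    circ-gadgetArcs : ∀ s k {ι : GadgetVertex s k → V} → (∀ {x y} → ι x ≡ ι y → x ≡ y) →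
                      ∀ {ms} → (∀ x → All (Avoids (ι x)) ms) → ∀ b → MidsBalanced ι b →
                      circ (map (image ι) (gadgetArcs s k) ++ ms) b ≡
                      circ (replicate k (pathWeight s , ι tail , ι head) ++ ms) b
    circ-gadgetArcs Sign.+ k {ι} _ {ms} _ b _ =
      cong (λ ns → circ (ns ++ ms) b) (map-replicate (image ι) k (tail , head))
    circ-gadgetArcs Sign.- k {ι} injective {ms} avoids b mids = trans
      (circ-paths injective avoids (allFin k) (allFin⁺ k) b mids)
      (cong (λ j → circ (replicate j (1ℤ , ι tail , ι head) ++ ms) b) (length-tabulate {n = k} (λ i → i)))

    circ-subdivided : ∀ s k {ι : GadgetVertex s k → V} → (∀ {x y} → ι x ≡ ι y → x ≡ y) →
                      ∀ {ms} → (∀ x → All (Avoids (ι x)) ms) →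
                      ∀ {v w} → (∀ x → v ≢ ι x) → (∀ x → w ≢ ι x) →
                      ∀ {b} → (∀ x → b (ι x) ≡ 0ℤ) →
                      circ ((-1ℤ , v , ι tail) ∷ (-1ℤ , ι head , w) ∷ map (image ι) (gadgetArcs s k) ++ ms) b ≡
                      circ ((- (s ◃ k) , v , w) ∷ ms) b
    circ-subdivided s k {ι} injective {ms} avoids {v} {w} v∉ w∉ {b} balanced = begin
      circ ((-1ℤ , v , ι tail) ∷ (-1ℤ , ι head , w) ∷ map (image ι) (gadgetArcs s k) ++ ms) b
        -- The two outer arcs come first in the list, so the gadget is rewritten separately under
        -- each of the four choices for them.
        ≡⟨ cong₂ step
             (cong₂ step (parallel b mids) (parallel (b ⊕ (ι head , w)) (from-head b mids)))
             (cong₂ step (parallel (b ⊕ (v , ι tail)) (to-tail b mids))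
                         (parallel (b ⊕ (v , ι tail) ⊕ (ι head , w))
                           (from-head (b ⊕ (v , ι tail)) (to-tail b mids)))) ⟩
      circ ((-1ℤ , v , ι tail) ∷ (-1ℤ , ι head , w) ∷
            replicate k (pathWeight s , ι tail , ι head) ++ ms) b
        ≡⟨ circ-gadget k (pathWeight s) (λ eq → contradiction (injective eq) λ ())
             (v∉ tail) (w∉ tail) (v∉ head) (w∉ head) (avoids tail) (avoids head)
             (balanced tail) (balanced head) ⟩
      circ ((+ k * pathWeight s , v , w) ∷ ms) b
        ≡⟨ cong (λ i → circ ((i , v , w) ∷ ms) b) (weight s) ⟩
      circ ((- (s ◃ k) , v , w) ∷ ms) b ∎
      where
      open ≡-Reasoning
      step : ℤ → ℤ → ℤ
      step i j = i + -1ℤ * j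
      parallel = circ-gadgetArcs s k injective avoids
      mids : MidsBalanced ι b
      mids x _ _ = balanced x
      to-tail : ∀ b → MidsBalanced ι b → MidsBalanced ι (b ⊕ (v , ι tail))
      to-tail b m x x≢tail x≢head =
        trans (⊕-avoids b (v∉ x) (λ eq → x≢tail (sym (injective eq)))) (m x x≢tail x≢head)
      from-head : ∀ b → MidsBalanced ι b → MidsBalanced ι (b ⊕ (ι head , w))
      from-head b m x x≢tail x≢head =
        trans (⊕-avoids b (λ eq → x≢head (sym (injective eq))) (w∉ x)) (m x x≢tail x≢head)
      weight : ∀ s → + k * pathWeight s ≡ - (s ◃ k)
      weight Sign.+ = trans (ℤ.*-comm (+ k) -1ℤ) (trans (ℤ.-1*i≡-i (+ k)) (cong -_ (sym (ℤ.+◃n≡+n k))))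
      weight Sign.- = trans (ℤ.*-identityʳ (+ k))
        (trans (sym (ℤ.neg-involutive (+ k))) (cong -_ (sym (ℤ.-◃n≡-n k))))

  module Contraction {G : Multigraph} (D : Orientation G)
                     (σ : Multigraph.Edge G → Sign) (φ⁺ : Multigraph.Edge G → ℕ) where

    open Multigraph G using (Vertex; Edge)
    open Orientation D
    private
      H = auxiliary D σ φ⁺
      module Aux = Circulations (Digraph._≟_ H) (Digraph.vertices H) (Digraph.complete H)
      module Old = Circulations Fin._≟_ (allFin (Multigraph.order G)) ∈-allFin
      open GadgetContraction (Digraph._≟_ H) (Digraph.vertices H) (Digraph.complete H)

    -- The weight, -φ(e) as an integer, serves twice: for the contracted gadget and as the
    -- coefficient of the target variable in the factor of `e`.
    contracted : Edge → WeightedArc Vertex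
    contracted e = - (σ e ◃ φ⁺ e) , source e , target e

    private
      signed : AuxVertex D σ φ⁺ × AuxVertex D σ φ⁺ → WeightedArc (AuxVertex D σ φ⁺)
      signed = -1ℤ ,_

      new-injective : ∀ {e} {x y : GadgetVertex (σ e) (φ⁺ e)} →
                      _≡_ {A = AuxVertex D σ φ⁺} (new e x) (new e y) → x ≡ y
      new-injective refl = refl

      new-edge : ∀ {e e′ x y} → _≡_ {A = AuxVertex D σ φ⁺} (new e x) (new e′ y) → e ≡ e′
      new-edge refl = refl

      old-injective : ∀ {v w} → _≡_ {A = AuxVertex D σ φ⁺} (old v) (old w) → v ≡ w
      old-injective refl = refl

    auxArcs-avoid : ∀ {e es} → All (e ≢_) es → ∀ x →
                    All (Aux.Avoids (new e x)) (map signed (concatMap (auxArcs D σ φ⁺) es))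
    auxArcs-avoid {e} []                 x = []
    auxArcs-avoid {e} {f ∷ es} (e≢f ∷ ∉) x =
      ((λ ()) , other) ∷ (other , (λ ())) ∷
      subst (All _) (sym (map-++ signed (map _ (gadgetArcs (σ f) (φ⁺ f))) _))
        (++⁺ (map⁺ (map⁺ (All.universal (λ _ → other , other) (gadgetArcs (σ f) (φ⁺ f)))))
             (auxArcs-avoid ∉ x))
      where
      other : ∀ {y} → _≢_ {A = AuxVertex D σ φ⁺} (new f y) (new e x)
      other eq = e≢f (sym (new-edge eq))

    -- Gadgets are contracted edge by edge. A contracted arc joins two old vertices, so the new
    -- vertices remain balanced in both branches; at the end only the balance of the old vertices is
    -- left to test.
    circ-auxiliary : ∀ es → Unique es → ∀ {b} → (∀ e x → b (new e x) ≡ 0ℤ) →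
                     Aux.circ (map signed (concatMap (auxArcs D σ φ⁺) es)) b ≡
                     Old.circ (map contracted es) (λ v → b (old v))
    circ-auxiliary [] [] {b} balanced =
      indicator-cong (λ z v → z (old v)) (λ where z (old v) → z v; z (new e x) → balanced e x)
        (Aux.balanced? b) (Old.balanced? _)
    circ-auxiliary (e ∷ es) (∉ ∷ es!) {b} balanced = begin
      Aux.circ (map signed (auxArcs D σ φ⁺ e ++ rest)) b
        ≡⟨ cong (λ ms → Aux.circ (first ∷ second ∷ ms) b) (split (gadgetArcs (σ e) (φ⁺ e))) ⟩
      Aux.circ (first ∷ second ∷ map (image (new e)) (gadgetArcs (σ e) (φ⁺ e)) ++ map signed rest) b
        ≡⟨ circ-subdivided (σ e) (φ⁺ e) new-injective (auxArcs-avoid ∉)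
             (λ x ()) (λ x ()) (balanced e) ⟩
      Aux.circ (map signed rest) b +
        - (σ e ◃ φ⁺ e) * Aux.circ (map signed rest) (b Aux.⊕ (old (source e) , old (target e)))
        ≡⟨ cong₂ (λ i j → i + - (σ e ◃ φ⁺ e) * j)
             (circ-auxiliary es es! balanced)
             (trans (circ-auxiliary es es! λ e′ x → trans
                      (Aux.⊕-avoids b {s = old (source e)} {t = old (target e)} (λ ()) (λ ())) (balanced e′ x))
                    (Old.circ-cong (map contracted es) λ v →
                      cong₂ (λ i j → b (old v) + i - j) (δ-old (source e) v) (δ-old (target e) v))) ⟩
      Old.circ (map contracted (e ∷ es)) (λ v → b (old v)) ∎
      where
      open ≡-Reasoning
      rest = concatMap (auxArcs D σ φ⁺) es
      first second : WeightedArc (AuxVertex D σ φ⁺)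
      first  = -1ℤ , old (source e) , new e tail
      second = -1ℤ , new e head , old (target e)
      split : ∀ as → map signed (map (λ a → new e (proj₁ a) , new e (proj₂ a)) as ++ rest) ≡
                     map (image (new e)) as ++ map signed rest
      split []       = refl
      split (a ∷ as) = cong (_ ∷_) (split as)
      δ-old : ∀ u v → Aux.δ (old u) (old v) ≡ Old.δ u v
      δ-old u v = indicator-cong old-injective (cong old) (Digraph._≟_ H (old u) (old v)) (u Fin.≟ v)

    EE-EO-contracted : + EE H - + EO H ≡ Old.circ (map contracted (allFin _)) (λ _ → 0ℤ)
    EE-EO-contracted = trans (SignedCount.EE-EO H) (circ-auxiliary (allFin _) (allFin⁺ _) λ _ _ → refl)

  -- Coefficients of products of linear forms, and circulations.

  sum-const-1 : ∀ n → sum {n} (λ _ → 1) ≡ n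
  sum-const-1 zero    = refl
  sum-const-1 (suc n) = cong suc (sum-const-1 n)

  sum-updateAt-suc : ∀ {n} (ℓ : Vector ℕ n) i → sum (updateAt ℓ i suc) ≡ suc (sum ℓ)
  sum-updateAt-suc ℓ zero    = refl
  sum-updateAt-suc ℓ (suc i) = trans (cong (ℓ zero ℕ.+_) (sum-updateAt-suc (Vector.tail ℓ) i)) (ℕ.+-suc (ℓ zero) _)

  n≤1+pred[n] : ∀ n → n ℕ.≤ suc (pred n)
  n≤1+pred[n] zero    = z≤n
  n≤1+pred[n] (suc n) = ℕ.≤-refl

  -- Equality fails only at an entry 0, which `pred` leaves fixed.
  sum-updateAt-pred : ∀ {n} (ℓ : Vector ℕ n) i → sum ℓ ℕ.≤ suc (sum (updateAt ℓ i pred))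
  sum-updateAt-pred ℓ zero    = ℕ.+-monoˡ-≤ (sum (Vector.tail ℓ)) (n≤1+pred[n] (ℓ zero))
  sum-updateAt-pred ℓ (suc i) =
    ℕ.≤-trans (ℕ.+-monoʳ-≤ (ℓ zero) (sum-updateAt-pred (Vector.tail ℓ) i)) (ℕ.≤-reflexive (ℕ.+-suc (ℓ zero) _))

  updateAt-≗ : ∀ {a n} {A : Set a} {f : A → A} {xs ys : Vector A n} → (∀ j → xs j ≡ ys j) →
                   ∀ i j → updateAt xs i f j ≡ updateAt ys i f j
  updateAt-≗ {n = suc _} {f = f} eq zero    zero    = cong f (eq zero)
  updateAt-≗ {n = suc _} eq zero    (suc j) = eq (suc j)
  updateAt-≗ {n = suc _} eq (suc i) zero    = eq zero
  updateAt-≗ {n = suc _} eq (suc i) (suc j) = updateAt-≗ (λ j → eq (suc j)) i j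

  module _ {n : ℕ} where

    -- The coefficient of ∏ x_v ^ (ℓ v - 1) in the product of the forms x_s + w x_t; the shift by one
    -- lets ℓ be the numbers of nodes, and ℓ v = 0 stands for a negative exponent and gives 0.
    coefficient : List (WeightedArc (Fin n)) → Vector ℕ n → ℤ
    coefficient []                 ℓ = indicator (Fin.all? λ v → ℓ v ℕ.≟ 1)
    coefficient ((w , s , t) ∷ ms) ℓ =
      coefficient ms (updateAt ℓ s pred) + w * coefficient ms (updateAt ℓ t pred)

    coefficient-cong : ∀ ms {ℓ ℓ′} → (∀ v → ℓ v ≡ ℓ′ v) → coefficient ms ℓ ≡ coefficient ms ℓ′
    coefficient-cong [] eq =
      indicator-cong (λ z v → trans (sym (eq v)) (z v)) (λ z v → trans (eq v) (z v)) (Fin.all? _) (Fin.all? _)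
    coefficient-cong ((w , s , t) ∷ ms) eq = cong₂ (λ i j → i + w * j)
      (coefficient-cong ms (updateAt-≗ eq s)) (coefficient-cong ms (updateAt-≗ eq t))

    -- The monomial has degree `sum ℓ - n`, more than the number of forms. Each `pred` lowers the
    -- sum by at most one, so at the end it still exceeds `n` and the entries cannot all be 1.
    coefficient-vanishes : ∀ ms {ℓ} → length ms ℕ.+ n ℕ.< sum ℓ → coefficient ms ℓ ≡ 0ℤ
    coefficient-vanishes [] n<sum =
      indicator-no (λ ones → ℕ.<-irrefl (sym (trans (sum-cong-≗ ones) (sum-const-1 n))) n<sum) (Fin.all? _)
    coefficient-vanishes ((w , s , t) ∷ ms) {ℓ} lt = trans
      (cong₂ (λ i j → i + w * j) (smaller s) (smaller t))
      (trans (ℤ.+-identityˡ (w * 0ℤ)) (ℤ.*-zeroʳ w))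
      where
      smaller : ∀ v → coefficient ms (updateAt ℓ v pred) ≡ 0ℤ
      smaller v = coefficient-vanishes ms (ℕ.s≤s⁻¹ (ℕ.≤-trans lt (sum-updateAt-pred ℓ v)))

  -- Truncation at 0 carries subtraction of 1 to `pred`, and it is harmless for `coefficient`, whose
  -- final test accepts the value 1 alone.
  infix 9 _⁺
  _⁺ : ℤ → ℕ
  (+ k) ⁺    = k
  -[1+ _ ] ⁺ = 0

  ⁺-pred : ∀ i → (i - 1ℤ) ⁺ ≡ pred (i ⁺)
  ⁺-pred (+ zero)  = refl
  ⁺-pred +[1+ k ]  = refl
  ⁺-pred -[1+ k ]  = refl

  ⁺≡1 : ∀ i → i ⁺ ≡ 1 → i ≡ 1ℤ
  ⁺≡1 (+ _) refl = refl

  module _ {n : ℕ} where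

    open Circulations {Fin n} Fin._≟_ (allFin n) ∈-allFin

    out : List (WeightedArc (Fin n)) → Fin n → ℤ
    out []                 v = 0ℤ
    out ((_ , s , _) ∷ ms) v = δ s v + out ms v

    updateAt-⁺ : ∀ (z : Fin n → ℤ) s v → updateAt (λ u → z u ⁺) s pred v ≡ (z v - δ s v) ⁺
    updateAt-⁺ z s v with s Fin.≟ v
    ... | yes refl = trans (updateAt-updates s _) (sym (⁺-pred (z v)))
    ... | no  s≢v  = trans (updateAt-minimal v s _ (λ eq → s≢v (sym eq))) (cong _⁺ (sym (ℤ.+-identityʳ (z v))))

    -- Dropping an arc corresponds to taking the source variable from its form, keeping it to taking
    -- the target variable. The exponent still to be produced at `v` is the number of remaining arcs
    -- out of `v` plus `b v`, and both choices preserve this relation.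
    circ-coefficient : ∀ ms b → circ ms b ≡ coefficient ms (λ v → (1ℤ + out ms v + b v) ⁺)
    circ-coefficient [] b = indicator-cong
      (λ z v → cong (λ i → (1ℤ + i) ⁺) (z v))
      (λ z v → trans (shift (b v)) (cong (_- 1ℤ) (⁺≡1 (1ℤ + b v) (z v))))
      (balanced? b) (Fin.all? _)
      where
      shift : ∀ i → i ≡ 1ℤ + i - 1ℤ
      shift = solve-∀
    circ-coefficient ((w , s , t) ∷ ms) b = cong₂ (λ i j → i + w * j)
      (trans (circ-coefficient ms b) (coefficient-cong ms λ v → sym
        (trans (updateAt-⁺ z s v) (cong _⁺ (rearrange₁ (δ s v) (out ms v) (b v))))))
      (trans (circ-coefficient ms (b ⊕ (s , t))) (coefficient-cong ms λ v → sym
        (trans (updateAt-⁺ z t v) (cong _⁺ (rearrange₂ (δ s v) (δ t v) (out ms v) (b v))))))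
      where
      z : Fin n → ℤ
      z v = 1ℤ + (δ s v + out ms v) + b v
      rearrange₁ : ∀ s o b → 1ℤ + (s + o) + b - s ≡ 1ℤ + o + b
      rearrange₁ = solve-∀
      rearrange₂ : ∀ s t o b → 1ℤ + (s + o) + b - t ≡ 1ℤ + o + (b + s - t)
      rearrange₂ = solve-∀

  module OrientationDegrees {G : Multigraph} (D : Orientation G) where

    open Multigraph G using (Edge; order)
    open Orientation D
    open Digraph digraph using (outdegreeIn; outdegree)

    out-outdegree : ∀ (w : Edge → ℤ) es v →
      out (map (λ e → w e , source e , target e) es) v ≡ + outdegreeIn (map (λ e → source e , target e) es) v
    out-outdegree w []       v = refl
    out-outdegree w (e ∷ es) v = trans
      (cong (λ i → indicator (source e Fin.≟ v) + i) (out-outdegree w es v))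
      (sym (SignedCount.+outdegreeIn-∷ digraph (source e) (target e) (map _ es) v))

    sum-outdegreeIn : ∀ as → sum (λ v → suc (outdegreeIn as v)) ≡ length as ℕ.+ order
    sum-outdegreeIn []             = sum-const-1 order
    sum-outdegreeIn ((s , t) ∷ as) = trans
      (sum-cong-≗ step) (trans (sum-updateAt-suc (λ u → suc (outdegreeIn as u)) s) (cong suc (sum-outdegreeIn as)))
      where
      step : ∀ v → suc (outdegreeIn ((s , t) ∷ as) v) ≡ updateAt (λ u → suc (outdegreeIn as u)) s ℕ.suc v
      step v with s Fin.≟ v
      ... | yes refl = sym (updateAt-updates s _)
      ... | no  s≢v  = sym (updateAt-minimal v s _ (λ eq → s≢v (sym eq)))

    -- With zero imbalance the exponents in `circ-coefficient` are the out-degrees, so the monomial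
    -- with these exponents carries the sum over Eulerian subdigraphs.
    circ-outdegree : ∀ (w : Edge → ℤ) → let ms = map (λ e → w e , source e , target e) (allFin _) in
      Circulations.circ Fin._≟_ (allFin order) ∈-allFin ms (λ _ → 0ℤ) ≡ coefficient ms (λ v → suc (outdegree v))
    circ-outdegree w = trans (circ-coefficient ms (λ _ → 0ℤ)) (coefficient-cong ms λ v →
      cong _⁺ (trans (ℤ.+-identityʳ _) (cong (λ i → 1ℤ + i) (out-outdegree w (allFin _) v))))
      where ms = map (λ e → w e , source e , target e) (allFin _)

open WeightedCounts

-- Integers in the field, and apartness from 0.

module FieldTheory {c ℓ₁ ℓ₂} (F : HeytingField c ℓ₁ ℓ₂) where

  open HeytingField F hiding (zero)
  open HeytingCommutativeRing heytingCommutativeRing using (commutativeRing)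
  open CommutativeRing commutativeRing using (ring; semiring)
  open HeytingProperties heytingCommutativeRing
  open RingProperties ring using (-0#≈0#; -‿involutive; -‿+-comm; -‿distribˡ-*; +-inverseˡ-unique)
  open Mult semiring using (×-homo-+; ×-congˡ; ×1-homo-*) renaming (_×_ to _·_)
  open SetoidReasoning setoid

  infix 9 _·1#
  _·1# : ℤ → Carrier
  i ·1# = _·1 F i

  ·1#-⊖ : ∀ m n → (m ⊖ n) ·1# ≈ m · 1# - n · 1#
  ·1#-⊖ zero    zero    = sym (x-0≈x 0#)
  ·1#-⊖ (suc m) zero    = sym (x-0≈x _)
  ·1#-⊖ zero    (suc n) = sym (+-identityˡ _)
  ·1#-⊖ (suc m) (suc n) = begin
    (suc m ⊖ suc n) ·1#                       ≡⟨ ≡.cong _·1# (ℤ.[1+m]⊖[1+n]≡m⊖n m n) ⟩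
    (m ⊖ n) ·1#                               ≈⟨ ·1#-⊖ m n ⟩
    m · 1# - n · 1#                         ≈⟨ +-congʳ (+-identityʳ _) ⟨
    m · 1# + 0# - n · 1#                    ≈⟨ +-congʳ (+-congˡ (-‿inverseʳ 1#)) ⟨
    m · 1# + (1# - 1#) - n · 1#             ≈⟨ +-congʳ (+-assoc _ 1# (- 1#)) ⟨
    m · 1# + 1# - 1# - n · 1#               ≈⟨ +-assoc _ (- 1#) _ ⟩
    m · 1# + 1# + (- 1# - n · 1#)           ≈⟨ +-cong (+-comm _ 1#) (-‿+-comm 1# _) ⟩
    1# + m · 1# - (1# + n · 1#)             ∎

  ·1#-+ : ∀ i j → (i ℤ.+ j) ·1# ≈ i ·1# + j ·1#
  ·1#-+ (pos m)  (pos n)  = ×-homo-+ 1# m n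
  ·1#-+ (pos m)  -[1+ n ] = ·1#-⊖ m (suc n)
  ·1#-+ -[1+ m ] (pos n)  = trans (·1#-⊖ n (suc m)) (+-comm _ _)
  ·1#-+ -[1+ m ] -[1+ n ] = begin
    - (suc (suc (m ℕ.+ n)) · 1#)     ≡⟨ ≡.cong (λ k → - (suc k · 1#)) (ℕ.+-suc m n) ⟨
    - ((suc m ℕ.+ suc n) · 1#)       ≈⟨ -‿cong (×-homo-+ 1# (suc m) (suc n)) ⟩
    - (suc m · 1# + suc n · 1#)      ≈⟨ -‿+-comm _ _ ⟨
    - (suc m · 1#) - (suc n · 1#)    ∎

  ·1#-neg : ∀ i → (ℤ.- i) ·1# ≈ - i ·1#
  ·1#-neg (pos zero)    = sym -0#≈0#
  ·1#-neg (pos (suc n)) = refl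
  ·1#-neg -[1+ n ]      = sym (-‿involutive _)

  ·1#-1 : 1ℤ ·1# ≈ 1#
  ·1#-1 = +-identityʳ 1#

  ·1#-pos* : ∀ m j → (pos m ℤ.* j) ·1# ≈ m · 1# * j ·1#
  ·1#-pos* zero    j = sym (zeroˡ _)
  ·1#-pos* (suc m) j = begin
    (pos (suc m) ℤ.* j) ·1#       ≡⟨ ≡.cong _·1# (ℤ.suc-* (pos m) j) ⟩
    (j ℤ.+ pos m ℤ.* j) ·1#       ≈⟨ ·1#-+ j (pos m ℤ.* j) ⟩
    j ·1# + (pos m ℤ.* j) ·1#       ≈⟨ +-cong (sym (*-identityˡ _)) (·1#-pos* m j) ⟩
    1# * j ·1# + m · 1# * j ·1#     ≈⟨ distribʳ _ _ _ ⟨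
    (1# + m · 1#) * j ·1#         ∎

  ·1#-* : ∀ i j → (i ℤ.* j) ·1# ≈ i ·1# * j ·1#
  ·1#-* (pos m)  j = ·1#-pos* m j
  ·1#-* -[1+ m ] j = begin
    (-[1+ m ] ℤ.* j) ·1#           ≡⟨ ≡.cong _·1# (ℤ.neg-distribˡ-* (pos (suc m)) j) ⟨
    (ℤ.- (pos (suc m) ℤ.* j)) ·1#  ≈⟨ ·1#-neg (pos (suc m) ℤ.* j) ⟩
    - (pos (suc m) ℤ.* j) ·1#      ≈⟨ -‿cong (·1#-pos* (suc m) j) ⟩
    - (suc m · 1# * j ·1#)         ≈⟨ -‿distribˡ-* _ _ ⟩
    - (suc m · 1#) * j ·1#         ∎

  private
    almostCommutativeRing : AlmostCommutativeRing c ℓ₁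
    almostCommutativeRing = fromCommutativeRing commutativeRing

    ·1#-morphism : ℤ.+-*-rawRing -Raw-AlmostCommutative⟶ almostCommutativeRing
    ·1#-morphism = record
      { ⟦_⟧    = _·1#
      ; +-homo = ·1#-+
      ; *-homo = ·1#-*
      ; -‿homo = ·1#-neg
      ; 0-homo = refl
      ; 1-homo = ·1#-1
      }

    -- Equality in the field need not be decidable. The ring solver compares integer coefficients,
    -- for which equality of the integers is a sufficient test.
    _·1#≟_ : ∀ i j → Maybe (i ·1# ≈ j ·1#)
    i ·1#≟ j with i ℤ.≟ j
    ... | yes i≡j = just (reflexive (≡.cong _·1# i≡j))
    ... | no  _   = nothing

  open RingSolver ℤ.+-*-rawRing almostCommutativeRing ·1#-morphism _·1#≟_
    using (solve; _:=_; _:+_; _:*_; _:-_; :-_; con)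

  *⇒#0 : ∀ {k x} → k * x ≈ 1# → x # 0#
  *⇒#0 {k} {x} eq = invertibleˡ⇒# (k , trans (*-congˡ (x-0≈x x)) eq)

  -- Apartness from 0 amounts to invertibility, and `y` times the inverse of `x * y` inverts `x`.
  *#0⇒ˡ : ∀ {x y} → x * y # 0# → x # 0#
  *#0⇒ˡ {x} {y} xy#0 with i , i*xy≈1 , _ ← #⇒invertible xy#0 =
    *⇒#0 {i * y} (trans (solve 3 (λ i x y → i :* y :* x := i :* (x :* y :- con 0ℤ)) refl i x y) i*xy≈1)

  *#0⇒ʳ : ∀ {x y} → x * y # 0# → y # 0#
  *#0⇒ʳ xy#0 = *#0⇒ˡ (#-congʳ (*-comm _ _) xy#0)

  -#0 : ∀ {x} → x # 0# → - x # 0#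
  -#0 {x} x#0 = *#0⇒ˡ {y = - 1ℤ ·1#} (#-congʳ (solve 1 (λ x → x := (:- x) :* (:- con 1ℤ)) refl x) x#0)

  -#0⁻¹ : ∀ {x} → - x # 0# → x # 0#
  -#0⁻¹ -x#0 = #-congʳ (-‿involutive _) (-#0 -x#0)

  -- Cotransitivity at the point `- y` leaves either `- y` apart from 0, or an invertible difference
  -- `x - y - (- y)`, which equals `x`. This replaces a decision whether `x` is 0.
  x-y#0⇒x#0⊎y#0 : ∀ {x y} → x - y # 0# → x # 0# ⊎ y # 0#
  x-y#0⇒x#0⊎y#0 {x} {y} x-y#0 with #-cotrans x-y#0 (- y)
  ... | inj₂ -y#0 = inj₂ (-#0⁻¹ -y#0)
  ... | inj₁ x-y#-y with i , i* , _ ← #⇒invertible x-y#-y =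
    inj₁ (*⇒#0 {i} (trans (solve 3 (λ i x y → i :* x := i :* (x :- y :- (:- y))) refl i x y) i*))

  abs#0⇒#0 : ∀ i → ∣ i ∣ · 1# # 0# → i ·1# # 0#
  abs#0⇒#0 (pos n)  n#0 = n#0
  abs#0⇒#0 -[1+ n ] n#0 = -#0 n#0

  module _ {p : ℕ} (isℤMod : IsℤMod F p) where

    private
      f = proj₁ isℤMod
      open IsRingIsomorphism (proj₂ isℤMod) using (⟦⟧-cong; +-homo; 1#-homo; 0#-homo)

    iso-·1 : ∀ n → f (pos n) ≈ n · 1#
    iso-·1 zero    = 0#-homo
    iso-·1 (suc n) = trans (+-homo 1ℤ (pos n)) (+-cong 1#-homo (iso-·1 n))

    p·1≈0 : p · 1# ≈ 0#
    p·1≈0 = begin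
      p · 1#     ≈⟨ iso-·1 p ⟨
      f (pos p)  ≈⟨ ⟦⟧-cong (∣ᵤ⇒∣ (ℕ.∣-reflexive (≡.cong ∣_∣ (≡.sym (ℤ.+-identityʳ (pos p)))))) ⟩
      f 0ℤ       ≈⟨ 0#-homo ⟩
      0#         ∎

    multiple·1≈0 : ∀ x → (x ℕ.* p) · 1# ≈ 0#
    multiple·1≈0 x = trans (×1-homo-* x p) (trans (*-congˡ p·1≈0) (zeroʳ _))

    -- Since the image of `p` is 0, a Bézout identity exhibits `y` or `- y` as an inverse of `n`.
    coprime⇒#0 : ∀ {n} → Coprime p n → n · 1# # 0#
    coprime⇒#0 {n} coprime with coprime-Bézout coprime
    ... | Bézout.+- x y 1+yn≡xp = *⇒#0 { - (y · 1#)} (begin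
      - (y · 1#) * n · 1#      ≈⟨ -‿distribˡ-* _ _ ⟨
      - (y · 1# * n · 1#)      ≈⟨ -‿cong (×1-homo-* y n) ⟨
      - ((y ℕ.* n) · 1#)       ≈⟨ +-inverseˡ-unique 1# _ (trans (×-congˡ 1+yn≡xp) (multiple·1≈0 x)) ⟨
      1#                       ∎)
    ... | Bézout.-+ x y 1+xp≡yn = *⇒#0 {y · 1#} (begin
      y · 1# * n · 1#          ≈⟨ ×1-homo-* y n ⟨
      (y ℕ.* n) · 1#           ≈⟨ ×-congˡ 1+xp≡yn ⟨
      1# + (x ℕ.* p) · 1#      ≈⟨ +-congˡ (multiple·1≈0 x) ⟩
      1# + 0#                  ≈⟨ +-identityʳ 1# ⟩
      1#                       ∎)

  prime∤⇒coprime : ∀ {p n} → Prime p → ¬ p ℕ.∣ n → Coprime p n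
  prime∤⇒coprime p-prime p∤n (d∣p , d∣n) with prime⇒irreducible p-prime d∣p
  ... | inj₁ d≡1      = d≡1
  ... | inj₂ ≡.refl   = contradiction d∣n p∤n

  -- A negation becomes an apartness by computing with integers: by cases on `i` in characteristic
  -- 0, and modulo `p` because a prime that does not divide `∣ i ∣` is coprime to it.
  ≢0⇒#0 : (K : CharZeroOrℤₚ F) → ∀ i → ¬ (i ≡0[ K ]) → i ·1# # 0#
  ≢0⇒#0 (char0 _)             (pos zero)      i≢0 = contradiction ≡.refl i≢0
  ≢0⇒#0 (char0 suc#0)         i@(pos (suc n)) i≢0 = suc#0 n
  ≢0⇒#0 (char0 suc#0)         i@(-[1+ n ])    i≢0 = -#0 (suc#0 n)
  ≢0⇒#0 (ℤₚ p p-prime isℤMod) i i≢0 =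
    abs#0⇒#0 i (coprime⇒#0 isℤMod (prime∤⇒coprime p-prime (λ p∣i → i≢0 (∣ᵤ⇒∣ p∣i))))

  -- Linear functionals and divided differences.

  module LinearFunctional {x} {X : Set x} (Λ : (X → Carrier) → Carrier)
    (linear : ∀ {h f g : X → Carrier} c → (∀ z → h z ≈ f z + c * g z) → Λ h ≈ Λ f + c * Λ g) where

    Λ-cong : ∀ {f g} → (∀ z → f z ≈ g z) → Λ f ≈ Λ g
    Λ-cong {f} {g} f≈g = begin
      Λ f              ≈⟨ linear 0# (λ z → trans (f≈g z) (0*-right (g z) (g z))) ⟩
      Λ g + 0# * Λ g   ≈⟨ 0*-right (Λ g) (Λ g) ⟨
      Λ g              ∎
      where
      0*-right : ∀ x y → x ≈ x + 0# * y
      0*-right = solve 2 (λ x y → x := x :+ con 0ℤ :* y) refl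

    Λ-zero : Λ (λ _ → 0#) ≈ 0#
    Λ-zero = begin
      Λ (λ _ → 0#)                           ≈⟨ linear (- 1ℤ ·1#) (λ _ → 0≈x-x 0#) ⟩
      Λ (λ _ → 0#) + - 1ℤ ·1# * Λ (λ _ → 0#)   ≈⟨ 0≈x-x _ ⟨
      0#                                     ∎
      where
      0≈x-x : ∀ x → 0# ≈ x + - 1ℤ ·1# * x
      0≈x-x = solve 1 (λ x → con 0ℤ := x :+ (:- con 1ℤ) :* x) refl

    Λ-* : ∀ c f → Λ (λ z → c * f z) ≈ c * Λ f
    Λ-* c f = begin
      Λ (λ z → c * f z)      ≈⟨ linear c (λ z → sym (+-identityˡ _)) ⟩
      Λ (λ _ → 0#) + c * Λ f ≈⟨ trans (+-congʳ Λ-zero) (+-identityˡ _) ⟩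
      c * Λ f                ∎

  -- Freshness with respect to apartness makes the nodes pairwise apart, so every difference of two
  -- of them has an inverse.
  Nodes : Set (c ⊔ ℓ₂)
  Nodes = List# Carrier _#_

  headOr0 : Nodes → Carrier
  headOr0 []          = 0#
  headOr0 (cons x _ _) = x

  tailOr[] : Nodes → Nodes
  tailOr[] []            = []
  tailOr[] (cons _ xs _) = xs

  inverse : ∀ {x y} → x # y → Carrier
  inverse x#y = proj₁ (#⇒invertible x#y)

  -- Newton's recursion. With the first node separated from the list, one recursive call deletes `x`
  -- and the other `y`, and both are structural.
  dividedFrom : ∀ x xs → Fresh.fresh Carrier _#_ x xs → (Carrier → Carrier) → Carrier
  dividedFrom x []               _            g = g x
  dividedFrom x (cons y ys y#ys) (x#y , x#ys) g =
    (dividedFrom y ys y#ys g - dividedFrom x ys x#ys g) * inverse (#-sym x#y)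

  -- With the value 0 on no nodes, the Leibniz rule below has no exceptional case.
  divided : Nodes → (Carrier → Carrier) → Carrier
  divided []               g = 0#
  divided (cons x xs x#xs) g = dividedFrom x xs x#xs g

  dividedFrom-linear : ∀ x xs x#xs {h f g} c → (∀ z → h z ≈ f z + c * g z) →
    dividedFrom x xs x#xs h ≈ dividedFrom x xs x#xs f + c * dividedFrom x xs x#xs g
  dividedFrom-linear x []               _            c eq = eq x
  dividedFrom-linear x (cons y ys y#ys) (x#y , x#ys) c eq = trans
    (*-congʳ (+-cong (dividedFrom-linear y ys y#ys c eq) (-‿cong (dividedFrom-linear x ys x#ys c eq))))
    (solve 6 (λ c i a b p q → ((a :+ c :* b) :- (p :+ c :* q)) :* i :=
                              (a :- p) :* i :+ c :* ((b :- q) :* i)) refl c _ _ _ _ _)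

  divided-linear : ∀ xs {h f g} c → (∀ z → h z ≈ f z + c * g z) →
                   divided xs h ≈ divided xs f + c * divided xs g
  divided-linear []               c eq = sym (trans (+-identityˡ _) (zeroʳ c))
  divided-linear (cons x xs x#xs) c eq = dividedFrom-linear x xs x#xs c eq

  -- In the recursion the terms `divided ys g` cancel, and the rest is
  -- `y a - x b = (y - x) a + x (a - b)` divided by `y - x`.
  dividedFrom-leibniz : ∀ x xs x#xs g →
    dividedFrom x xs x#xs (λ z → z * g z) ≈ divided xs g + x * dividedFrom x xs x#xs g
  dividedFrom-leibniz x []               _            g = sym (+-identityˡ _)
  dividedFrom-leibniz x (cons y ys y#ys) (x#y , x#ys) g = begin
    (dividedFrom y ys y#ys (λ z → z * g z) - dividedFrom x ys x#ys (λ z → z * g z)) * i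
      ≈⟨ *-congʳ (+-cong (dividedFrom-leibniz y ys y#ys g) (-‿cong (dividedFrom-leibniz x ys x#ys g))) ⟩
    ((divided ys g + y * a) - (divided ys g + x * b)) * i
      ≈⟨ solve 6 (λ s x y a b i → ((s :+ y :* a) :- (s :+ x :* b)) :* i :=
                                  i :* (y :- x) :* a :+ x :* ((a :- b) :* i)) refl (divided ys g) x y a b i ⟩
    i * (y - x) * a + x * ((a - b) * i)
      ≈⟨ +-congʳ (trans (*-congʳ (proj₁ (proj₂ (#⇒invertible (#-sym x#y))))) (*-identityˡ a)) ⟩
    a + x * ((a - b) * i) ∎
    where
    i = inverse (#-sym x#y)
    a = dividedFrom y ys y#ys g
    b = dividedFrom x ys x#ys g

  divided-leibniz : ∀ xs g →
    divided xs (λ z → z * g z) ≈ divided (tailOr[] xs) g + headOr0 xs * divided xs g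
  divided-leibniz []               g = sym (trans (+-identityˡ _) (zeroʳ _))
  divided-leibniz (cons x xs x#xs) g = dividedFrom-leibniz x xs x#xs g

  divided-const-zero : ∀ xs k → Fresh.length xs ≢ 1 → divided xs (λ _ → k) ≈ 0#
  divided-const-zero []                             k ≢1 = refl
  divided-const-zero (cons x [] _)                  k ≢1 = contradiction ≡.refl ≢1
  divided-const-zero (cons x (cons y ys y#ys) x#xs) k ≢1 = long x y ys y#ys x#xs
    where
    long : ∀ x y ys y#ys x#xs → dividedFrom x (cons y ys y#ys) x#xs (λ _ → k) ≈ 0#
    long x y []                 _            (x#y , _)    = trans (*-congʳ (-‿inverseʳ k)) (zeroˡ _)
    long x y (cons z zs z#zs) y#zs (x#y , x#zs) = trans
      (*-congʳ (trans (+-cong (long y z zs z#zs y#zs) (-‿cong (long x z zs z#zs x#zs))) (-‿inverseʳ 0#)))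
      (zeroˡ _)

  divided-const-one : ∀ xs k → Fresh.length xs ≡ 1 → divided xs (λ _ → k) ≈ k
  divided-const-one (cons x [] _) k ≡.refl = refl

  -- Along the recursion, apartness from 0 passes to one of the two smaller divided differences
  -- until a single value is reached. `P` carries list membership to the point found.
  dividedFrom#0 : ∀ {q} {P : Carrier → Set q} x xs x#xs {g} → P x → All# P xs →
                  dividedFrom x xs x#xs g # 0# → ∃ λ z → P z × g z # 0#
  dividedFrom#0 x []               _            px []         g#0 = x , px , g#0
  dividedFrom#0 x (cons y ys y#ys) (x#y , x#ys) px (py ∷ pys) d#0 with x-y#0⇒x#0⊎y#0 (*#0⇒ˡ d#0)
  ... | inj₁ y#0 = dividedFrom#0 y ys y#ys py pys y#0
  ... | inj₂ x#0 = dividedFrom#0 x ys x#ys px pys x#0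

  divided#0 : ∀ {q} {P : Carrier → Set q} xs {g} → All# P xs →
              divided xs g # 0# → ∃ λ z → P z × g z # 0#
  divided#0 []               []         0#0 = contradiction 0#0 (#-irrefl refl)
  divided#0 (cons x xs x#xs) (px ∷ pxs) d#0 = dividedFrom#0 x xs x#xs px pxs d#0

  -- Tensor products of divided differences.

  tensor : ∀ {n} → Vector Nodes n → (Vector Carrier n → Carrier) → Carrier
  tensor {zero}  xs Q = Q Vector.[]
  tensor {suc n} xs Q = divided (xs zero) (λ x → tensor (Vector.tail xs) (λ f → Q (x Vector.∷ f)))

  tensor-linear : ∀ {n} (xs : Vector Nodes n) {h f g} c → (∀ z → h z ≈ f z + c * g z) →
                  tensor xs h ≈ tensor xs f + c * tensor xs g
  tensor-linear {zero}  xs c eq = eq _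
  tensor-linear {suc n} xs c eq =
    divided-linear (xs zero) c (λ x → tensor-linear (Vector.tail xs) c (λ f → eq (x Vector.∷ f)))

  module Divided (xs : Nodes) = LinearFunctional (divided xs) (divided-linear xs)
  module Tensor {n} (xs : Vector Nodes n) = LinearFunctional (tensor xs) (tensor-linear xs)

  -- For the first coordinate, `f zero` is a scalar to the inner functional and the one-variable
  -- rule acts outside; for a later coordinate, the rule holds inside and linearity carries it out.
  tensor-leibniz : ∀ {n} (xs : Vector Nodes n) v Q →
    tensor xs (λ f → f v * Q f) ≈ tensor (updateAt xs v tailOr[]) Q + headOr0 (xs v) * tensor xs Q
  tensor-leibniz {suc n} xs zero    Q = trans
    (Divided.Λ-cong (xs zero) (λ x → Tensor.Λ-* (Vector.tail xs) x (λ f → Q (x Vector.∷ f))))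
    (divided-leibniz (xs zero) _)
  tensor-leibniz {suc n} xs (suc v) Q =
    divided-linear (xs zero) _ (λ x → tensor-leibniz (Vector.tail xs) v (λ f → Q (x Vector.∷ f)))

  -- Each coordinate contributes a factor 1 on a single node and 0 otherwise. The decision is an
  -- argument so that the recursion can supply its own.
  tensor-one : ∀ {n} (xs : Vector Nodes n) (ones? : Dec (∀ v → Fresh.length (xs v) ≡ 1)) →
               tensor xs (λ _ → 1ℤ ·1#) ≈ indicator ones? ·1#
  tensor-one {zero}  xs (yes _)    = refl
  tensor-one {zero}  xs (no ¬ones) = contradiction (λ ()) ¬ones
  tensor-one {suc n} xs (yes ones) = trans
    (Divided.Λ-cong (xs zero) (λ _ → tensor-one (Vector.tail xs) (yes (λ v → ones (suc v)))))
    (divided-const-one (xs zero) _ (ones zero))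
  tensor-one {suc n} xs (no ¬ones) with Fresh.length (xs zero) ℕ.≟ 1
  ... | no  ≢1 = divided-const-zero (xs zero) _ ≢1
  ... | yes ≡1 = trans
    (Divided.Λ-cong (xs zero) (λ _ → tensor-one (Vector.tail xs)
      (no (λ ones → ¬ones λ where zero → ≡1; (suc v) → ones v))))
    (Divided.Λ-zero (xs zero))

  tensor#0 : ∀ {q n} (P : Fin n → Carrier → Set q) (xs : Vector Nodes n) {Q} →
             (∀ v → All# (P v) (xs v)) → tensor xs Q # 0# →
             ∃ λ f → (∀ v → P v (f v)) × Q f # 0#
  tensor#0 {n = zero}  P xs all Q#0 = Vector.[] , (λ ()) , Q#0
  tensor#0 {n = suc n} P xs all d#0
    with x , px , t#0 ← divided#0 (xs zero) (all zero) d#0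
    with f , pf , Q#0 ← tensor#0 (λ v → P (suc v)) (Vector.tail xs) (λ v → all (suc v)) t#0 =
    x Vector.∷ f , (λ where zero → px; (suc v) → pf v) , Q#0

  -- Products of affine forms and a nonvanishing criterion.

  LinearForm : ℕ → Set c
  LinearForm n = WeightedArc (Fin n) × Carrier

  eval : ∀ {n} → LinearForm n → Vector Carrier n → Carrier
  eval ((w , s , t) , k) f = (f s + w ·1# * f t) + k

  signed-form-vanishes : ∀ {φ x y k} i → φ ≈ i ·1# → x - φ * y ≈ k → (x + (ℤ.- i) ·1# * y) - k ≈ 0#
  signed-form-vanishes {φ} {x} {y} {k} i φ≈i x-φy≈k = begin
    (x + (ℤ.- i) ·1# * y) - k   ≈⟨ +-congʳ (+-congˡ (*-congʳ (trans (·1#-neg i) (-‿cong (sym φ≈i))))) ⟩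
    (x + - φ * y) - k           ≈⟨ +-congʳ (+-congˡ (-‿distribˡ-* φ y)) ⟨
    (x - φ * y) - k             ≈⟨ +-congʳ x-φy≈k ⟩
    k - k                       ≈⟨ -‿inverseʳ k ⟩
    0#                          ∎

  -- The empty product is the image of the integer 1, so that it agrees definitionally with the
  -- indicator in `tensor-one`.
  productOf : ∀ {n} → List (LinearForm n) → Vector Carrier n → Carrier
  productOf []       f = 1ℤ ·1#
  productOf (l ∷ ls) f = eval l f * productOf ls f

  productOf#0 : ∀ {n} (ls : List (LinearForm n)) {f} → productOf ls f # 0# → All (λ l → eval l f # 0#) ls
  productOf#0 []       _    = []
  productOf#0 (l ∷ ls) l*#0 = *#0⇒ˡ l*#0 ∷ productOf#0 ls (*#0⇒ʳ l*#0)

  -- `tailOr[]` and `pred` both fix the empty case, so the numbers of nodes follow the shifted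
  -- exponents of `coefficient`.
  tailOr[]-length : ∀ xs → Fresh.length (tailOr[] xs) ≡ pred (Fresh.length xs)
  tailOr[]-length []           = ≡.refl
  tailOr[]-length (cons _ _ _) = ≡.refl

  lengths : ∀ {n} → Vector Nodes n → Vector ℕ n
  lengths xs v = Fresh.length (xs v)

  -- The degree of the product is at most that of the monomial, so only the part of top degree
  -- survives. By `tensor-leibniz`, multiplication by `f v` removes a node at `v`, just as choosing
  -- the variable of `v` lowers its exponent.
  tensor-productOf : ∀ {n} (ls : List (LinearForm n)) (xs : Vector Nodes n) →
                     length ls ℕ.+ n ℕ.≤ sum (lengths xs) →
                     tensor xs (productOf ls) ≈ coefficient (map proj₁ ls) (lengths xs) ·1#
  tensor-productOf [] xs _ = tensor-one xs (Fin.all? _)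
  tensor-productOf {n} (((w , s , t) , k) ∷ ls) xs le = begin
    tensor xs (productOf (((w , s , t) , k) ∷ ls))
      ≈⟨ tensor-linear xs k (λ f → solve 5 (λ x w y k q →
           ((x :+ w :* y) :+ k) :* q := (x :* q :+ w :* (y :* q)) :+ k :* q) refl
           (f s) (w ·1#) (f t) k (productOf ls f)) ⟩
    tensor xs (λ f → f s * productOf ls f + w ·1# * (f t * productOf ls f)) + k * tensor xs (productOf ls)
      ≈⟨ +-cong (tensor-linear xs (w ·1#) (λ f → refl)) (trans (*-congˡ vanish) (zeroʳ k)) ⟩
    tensor xs (λ f → f s * productOf ls f) + w ·1# * tensor xs (λ f → f t * productOf ls f) + 0#
      ≈⟨ trans (+-identityʳ _) (+-cong (shorten s) (*-congˡ (shorten t))) ⟩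
    coefficient ms (updateAt (lengths xs) s pred) ·1# + w ·1# * coefficient ms (updateAt (lengths xs) t pred) ·1#
      ≈⟨ +-congˡ (·1#-* w _) ⟨
    coefficient ms (updateAt (lengths xs) s pred) ·1# + (w ℤ.* coefficient ms (updateAt (lengths xs) t pred)) ·1#
      ≈⟨ ·1#-+ (coefficient ms (updateAt (lengths xs) s pred)) _ ⟨
    coefficient ((w , s , t) ∷ ms) (lengths xs) ·1# ∎
    where
    ms = map proj₁ ls
    -- Only ls is left after the constant k is chosen, and its degree is too small.
    vanish : tensor xs (productOf ls) ≈ 0#
    vanish = trans (tensor-productOf ls xs (ℕ.≤-trans (ℕ.n≤1+n _) le))
      (reflexive (≡.cong _·1# (coefficient-vanishes ms
        (≡.subst (λ m → m ℕ.+ n ℕ.< sum (lengths xs)) (≡.sym (length-map proj₁ ls)) le))))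
    lengths-tail : ∀ v u → lengths (updateAt xs v tailOr[]) u ≡ updateAt (lengths xs) v pred u
    lengths-tail v = map-updateAt {f = Fresh.length} tailOr[]-length xs v
    shorten : ∀ v → tensor xs (λ f → f v * productOf ls f) ≈ coefficient ms (updateAt (lengths xs) v pred) ·1#
    shorten v = begin
      tensor xs (λ f → f v * productOf ls f)
        ≈⟨ tensor-leibniz xs v (productOf ls) ⟩
      tensor (updateAt xs v tailOr[]) (productOf ls) + headOr0 (xs v) * tensor xs (productOf ls)
        -- The second Leibniz term keeps all nodes although one form is already used up.
        ≈⟨ trans (+-congˡ (trans (*-congˡ vanish) (zeroʳ _))) (+-identityʳ _) ⟩
      tensor (updateAt xs v tailOr[]) (productOf ls)
        ≈⟨ tensor-productOf ls (updateAt xs v tailOr[]) (ℕ.s≤s⁻¹ (ℕ.≤-trans le (ℕ.≤-trans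
             (sum-updateAt-pred (lengths xs) v)
             (s≤s (ℕ.≤-reflexive (sum-cong-≗ (λ u → ≡.sym (lengths-tail v u)))))))) ⟩
      coefficient ms (lengths (updateAt xs v tailOr[])) ·1#
        ≡⟨ ≡.cong _·1# (coefficient-cong ms (lengths-tail v)) ⟩
      coefficient ms (updateAt (lengths xs) v pred) ·1# ∎

  -- A combinatorial Nullstellensatz for products of affine forms: the coefficient, apart from 0 in
  -- the field, is a combination of values on the grid of nodes, so one of these values is apart
  -- from 0.
  nonvanishing-point : ∀ {q n} (K : CharZeroOrℤₚ F) (P : Fin n → Carrier → Set q)
    (ls : List (LinearForm n)) (xs : Vector Nodes n) → (∀ v → All# (P v) (xs v)) →
    length ls ℕ.+ n ℕ.≤ sum (lengths xs) → ¬ (coefficient (map proj₁ ls) (lengths xs) ≡0[ K ]) →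
    ∃ λ f → (∀ v → P v (f v)) × All (λ l → eval l f # 0#) ls
  nonvanishing-point K P ls xs all le ≢0
    with f , pf , ls#0 ← tensor#0 P xs all (#-congʳ (sym (tensor-productOf ls xs le)) (≢0⇒#0 K _ ≢0)) =
    f , pf , productOf#0 ls ls#0

  -- Mutual with `fresh-nodes`, as extending a fresh list requires a proof that the new head is
  -- apart from all its nodes.
  nodes : ∀ {k} (x : Fin k → Carrier) → (∀ {i j} → i ≢ j → x i # x j) → Nodes
  fresh-nodes : ∀ {k} {y} {x : Fin k → Carrier} (distinct : ∀ {i j} → i ≢ j → x i # x j) →
                (∀ i → y # x i) → Fresh.fresh Carrier _#_ y (nodes x distinct)

  nodes {zero}  x distinct = []
  nodes {suc k} x distinct = cons (x zero)
    (nodes (λ i → x (suc i)) (λ i≢j → distinct (λ eq → i≢j (Fin.suc-injective eq))))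
    (fresh-nodes _ (λ i → distinct λ ()))

  fresh-nodes {zero}  distinct y# = tt
  fresh-nodes {suc k} distinct y# = y# zero , fresh-nodes _ (λ i → y# (suc i))

  length-nodes : ∀ {k} (x : Fin k → Carrier) (distinct : ∀ {i j} → i ≢ j → x i # x j) →
                 Fresh.length (nodes x distinct) ≡ k
  length-nodes {zero}  x distinct = ≡.refl
  length-nodes {suc k} x distinct = ≡.cong suc (length-nodes (λ i → x (suc i)) _)

  all-nodes : ∀ {q k} {P : Carrier → Set q} {x : Fin k → Carrier} (distinct : ∀ {i j} → i ≢ j → x i # x j) →
              (∀ i → P (x i)) → All# P (nodes x distinct)
  all-nodes {k = zero}  distinct px = []
  all-nodes {k = suc k} distinct px = px zero ∷ all-nodes _ (λ i → px (suc i))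

-- From a nonvanishing point to a colouring.

open import Data.Integer.Base using (+_; _-_)

theorem20 : ∀ {c ℓ₁ ℓ₂ a b} (G : Multigraph) (F : HeytingField c ℓ₁ ℓ₂) (K : CharZeroOrℤₚ F) →
    let open Multigraph G in
    (A : CorrespondenceAssignment F G a b) (D : Orientation G) →
    let open CorrespondenceAssignment A in
    (φ : Edge → HeytingField.Carrier F) → IsGeneralizedSign A D φ →
    (σ : Edge → Sign) (φ⁺ : Edge → ℕ) → IsSignDecomposition K φ σ φ⁺ →
    let Dσφ = auxiliary D σ φ⁺ in
    ¬ ((+ EE Dσφ) - (+ EO Dσφ) ≡0[ K ]) →
    ((v : Vertex) → AtLeast F (suc (Digraph.outdegree (Orientation.digraph D) v)) (L v)) →
    Colorable
theorem20 G F K A D φ isGeneralizedSign σ φ⁺ isSignDecomposition EE-EO≢0 atLeast =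
  coloring (nonvanishing-point K L forms xs
    (λ v → all-nodes (proj₂ (proj₂ (atLeast v))) (proj₁ (proj₂ (atLeast v)))) enough-nodes
    (λ coefficient≡0 → EE-EO≢0 (≡.subst (_≡0[ K ]) coefficient≡EE-EO coefficient≡0)))
  where
  open Multigraph G using (Vertex; Edge; Joins; order; size)
  open Orientation D using (source; target; joins; digraph)
  open CorrespondenceAssignment A using (L; C; C-sym; Colorable)
  open HeytingField F using (_#_; 0#; -_; #-irrefl)
  open IsGeneralizedSign isGeneralizedSign using (affine)
  open IsSignDecomposition isSignDecomposition using (decomposes)
  open FieldTheory F
  open Contraction D σ φ⁺ using (contracted; EE-EO-contracted)
  open OrientationDegrees D using (circ-outdegree; sum-outdegreeIn)

  form : Edge → LinearForm order
  form e = contracted e , - proj₁ (affine e)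

  forms : List (LinearForm order)
  forms = map form (allFin size)

  xs : Vertex → Nodes
  xs v = nodes (proj₁ (atLeast v)) (proj₂ (proj₂ (atLeast v)))

  lengths-xs : ∀ v → lengths xs v ≡ suc (Digraph.outdegree digraph v)
  lengths-xs v = length-nodes (proj₁ (atLeast v)) (proj₂ (proj₂ (atLeast v)))

  coefficient≡EE-EO : coefficient (map proj₁ forms) (lengths xs) ≡
                      + EE (auxiliary D σ φ⁺) - + EO (auxiliary D σ φ⁺)
  coefficient≡EE-EO = begin
    coefficient (map proj₁ forms) (lengths xs)
      ≡⟨ ≡.cong (λ ms → coefficient ms (lengths xs)) (map-∘ (allFin size)) ⟨
    coefficient (map contracted (allFin size)) (lengths xs)
      ≡⟨ coefficient-cong (map contracted (allFin size)) lengths-xs ⟩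
    coefficient (map contracted (allFin size)) (λ v → suc (Digraph.outdegree digraph v))
      ≡⟨ circ-outdegree (λ e → ℤ.- (σ e ◃ φ⁺ e)) ⟨
    Circulations.circ Fin._≟_ (allFin order) ∈-allFin (map contracted (allFin size)) (λ _ → 0ℤ)
      ≡⟨ EE-EO-contracted ⟨
    + EE (auxiliary D σ φ⁺) - + EO (auxiliary D σ φ⁺) ∎
    where open ≡.≡-Reasoning

  -- In fact an equality: summing d⁺(v) + 1 over the vertices counts every edge at its source and
  -- every vertex once.
  enough-nodes : length forms ℕ.+ order ℕ.≤ sum (lengths xs)
  enough-nodes = ℕ.≤-reflexive (begin
    length forms ℕ.+ order
      ≡⟨ ≡.cong (ℕ._+ order) (≡.trans (length-map form (allFin size)) (≡.sym (length-map _ (allFin size)))) ⟩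
    length (Digraph.arcs digraph) ℕ.+ order
      ≡⟨ sum-outdegreeIn (Digraph.arcs digraph) ⟨
    sum (λ v → suc (Digraph.outdegree digraph v))
      ≡⟨ sum-cong-≗ lengths-xs ⟨
    sum (lengths xs) ∎)
    where open ≡.≡-Reasoning

  coloring : (∃ λ f → (∀ v → f v ∈ L v) × All (λ l → eval l f # 0#) forms) → Colorable
  coloring (f , f∈L , forms#0) = f , f∈L , λ e v w → avoids-joined e (joins e)
    where
    -- A matched pair would make the factor of `e` vanish, whereas all factors are apart from 0 at
    -- `f`.
    avoids : ∀ e → ¬ C e (source e , f (source e)) (target e , f (target e))
    avoids e matched = #-irrefl
      (signed-form-vanishes (σ e ◃ φ⁺ e) (decomposes e) (proj₂ (affine e) matched))
      (All.lookup (map⁻ forms#0) (∈-allFin e))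

    -- The ends may be named in either order, so up to `C-sym` the pair is the one along the
    -- orientation.
    avoids-joined : ∀ e {v w} → Joins e (source e) (target e) → Joins e v w → ¬ C e (v , f v) (w , f w)
    avoids-joined e (inj₁ eq) (inj₁ eq′) c with ≡.refl ← ≡.trans (≡.sym eq) eq′ = avoids e c
    avoids-joined e (inj₁ eq) (inj₂ eq′) c with ≡.refl ← ≡.trans (≡.sym eq) eq′ = avoids e (C-sym e c)
    avoids-joined e (inj₂ eq) (inj₁ eq′) c with ≡.refl ← ≡.trans (≡.sym eq) eq′ = avoids e (C-sym e c)
    avoids-joined e (inj₂ eq) (inj₂ eq′) c with ≡.refl ← ≡.trans (≡.sym eq) eq′ = avoids e c
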